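{- For every even integer $r\ge 4$ and every integer $t\ge 1$, the graphs $G_{r,t}$ and $H_{r,t}$ (defined in the context) are connected, nonisomorphic, have the same degree sequence, and each have $$n_{r,t}=rt+\frac{r(r+1)}{2}+C_r,\qquad C_r=\binom r2+\frac{r!}{2\,(r/2)!},$$ vertices. Moreover, $$b(G_{r,t},H_{r,t})\ \ge\ L_{r,t}=(r-1)t+\frac{r(r+1)}{2}-1,$$ and therefore, for every even $r\ge 4$, $$\liminf_{t\to\infty}\frac{b(G_{r,t},H_{r,t})}{n_{r,t}}\ \ge\ 1-\frac1r.$$
   Context: All graphs are finite and simple. For a graph $G$ and $v\in V(G)$, the graph $G-v$ (up to isomorphism) is a card of $G$; the vertex deck $\mathcal D(G)=\{G-v:v\in V(G)\}$ is a multiset. For graphs $G,H$ of the same order, $b(G,H)=|\mathcal D(G)\cap\mathcal D(H)|$ (multiset intersection); equivalently, the maximum $m$ such that there are $m$ distinct vertices $v_i$ of $G$ and $m$ distinct vertices $w_i$ of $H$ with $G-v_i\cong H-w_i$ for all $i\le m$. Two graphs have the same degree sequence if their multisets of vertex degrees agree. Let $r=2k\ge 4$ be even, $[r]=\{1,\dots,r\}$, and let $\operatorname{Even}(r)$ be the group of even permutations of $[r]$. A permutation $\sigma$ of $[r]$ acts on a graph $F$ with vertex set $[r]$ by letting $\sigma F$ be the graph on $[r]$ with edges $\sigma(i)\sigma(j)$ for $ij\in E(F)$. Seed graph $X_r$: write the label set as $[r]=A\cup D$ with $A=\{a_1,\dots,a_k\}$, $D=\{d_1,\dots,d_k\}$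 disjoint (a fixed labeling of $[r]$). $X_r$ is the graph on $[r]$ in which $A$ is a clique, $D$ is an independent set, and the only edges between $A$ and $D$ are $a_id_i$ for $i=1,\dots,k$. Let $\mathcal F_r=\{\sigma X_r:\sigma\in\operatorname{Even}(r)\}$, a set of labeled graphs on $[r]$. Selector $S_r$: its vertices are ports $p_1,\dots,p_r$, one pair vertex $q_{ij}$ for each unordered pair $\{i,j\}\subseteq[r]$ with $i\ne j$, and one selector vertex $z_F$ for each $F\in\mathcal F_r$. The edges are: $p_i$ is adjacent to every pair vertex whose index pair contains $i$; the vertices $z_F$ form a clique; and $z_F$ is adjacent to $q_{ij}$ exactly when $ij\in E(F)$. There are no other edges. Blow-up: for a vector $\mathbf a=(a_1,\dots,a_r)$ of integers with every $a_i\ge 2$, $S_r(\mathbf a)$ is the graph obtained from $S_r$ by replacing each port $p_i$ with an independent set $P_i$ of $a_i$ vertices, each having the same neighborhood as $p_i$ had in $S_r$ (namely all pair vertices whose index pair contains $i$). For $t\ge 1$ put $\mathbf a(t)=(t+1,t+2,t+3,\dots,t+r)$ and $\mathbf b(t)=(t+2,t+1,t+3,\dots,t+r)$ (the first two entries swapped), and set $G_{r,t}=S_r(\mathbf a(t))$, $H_{r,t}=S_r(\mathbf b(t))$. -}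

module Defs where

open import Data.Bool.Base using (Bool; true; false; not; _∨_)
import Data.Bool.Properties as Bool
open import Data.Fin.Base as Fin using (Fin; zero; suc; toℕ)
open import Data.Fin.Patterns using (0F)
open import Data.Fin.Permutation as Perm
  using (Permutation; Permutation′; _⟨$⟩ʳ_; _⟨$⟩ˡ_; insert; remove; insert-remove)
import Data.Fin.Properties as Fin
open import Data.Irrelevant using ([_])
open import Data.List.Base as List using (List; []; _∷_; length; filter; filterᵇ; allFin)
open import Data.List.Membership.Propositional using (_∈_; find; lose)
import Data.List.Membership.Propositional.Properties as ∈
open import Data.List.Properties using (filter-≐)
open import Data.List.Relation.Binary.Permutation.Propositional using (_↭_)
import Data.List.Relation.Unary.All as All
import Data.List.Relation.Unary.AllPairs as AllPairs
open import Data.List.Relation.Unary.Any as Any using (Any; here; there; any?)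
import Data.List.Relation.Unary.Any.Properties as Any
open import Data.List.Relation.Unary.Unique.Propositional using (Unique)
import Data.List.Relation.Unary.Unique.DecPropositional.Properties as Unique
open import Data.Nat.Base
  using (ℕ; zero; suc; _+_; _*_; _∸_; _≤_; _!; NonZero; NonTrivial;
         nonTrivial⇒nonZero; >-nonZero; >-nonZero⁻¹)
open import Data.Nat.Combinatorics using (_C_)
open import Data.Nat.Divisibility using (_∣_; _∣?_)
open import Data.Nat.DivMod using (_/_; m≥n⇒m/n>0)
import Data.Nat.Properties as ℕ
open import Data.Product.Base using (Σ; ∃; ∃-syntax; Σ-syntax; _×_; _,_; proj₁; proj₂)
import Data.Product.Properties as Product
open import Data.Rational.Base as ℚ using (ℚ; 0ℚ)
open import Data.Refinement using (Refinement; Refinement-syntax; value)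
  renaming (_,_ to _,ᵣ_)
import Data.Refinement.Properties as Refinement
open import Data.Sum.Base as Sum using (_⊎_; inj₁; inj₂)
open import Data.Sum.Function.Propositional using (_⊎-↔_)
open import Data.Vec.Base as Vec using (Vec; lookup)
import Data.Vec.Functional as Vector
import Data.Vec.Properties as Vec
open import Function.Base using (_∘_)
open import Function.Bundles using (_↔_; Injection; Inverse; mk↔ₛ′)
open import Function.Construct.Composition using (_↔-∘_)
open import Function.Construct.Identity using (↔-id)
open import Function.Construct.Symmetry using (↔-sym)
open import Function.Definitions using (Injective)
open import Function.Properties.Inverse using (↔⇒↣)
open import Relation.Binary.Construct.Closure.ReflexiveTransitive using (Star)
open import Relation.Binary.Definitions using (DecidableEquality)
open import Relation.Binary.PropositionalEquality
  using (_≡_; _≢_; _≗_; refl; sym; trans; cong; cong₂; subst)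
open import Relation.Nullary using (¬_; Dec; yes; no; contradiction)
open import Relation.Nullary.Decidable as Dec using (⌊_⌋; _×-dec_; _→-dec_; recompute; via-injection)
open import Relation.Unary using (Decidable)

open Inverse using (to; from)

private
  variable
    A B : Set
    k m n r : ℕ

------------------------------------------------------------------------
-- Finite types

record Finite (A : Set) : Set where
  field
    size  : ℕ
    index : A ↔ Fin size

  elements : List A
  elements = List.map (from index) (allFin size)

  ∈-elements : ∀ x → x ∈ elements
  ∈-elements x = subst (_∈ elements) (Inverse.strictlyInverseʳ index x)
                   (∈.∈-map⁺ (from index) (∈.∈-allFin (to index x)))

  _≟_ : DecidableEquality A
  _≟_ = via-injection (↔⇒↣ index) Fin._≟_

  ∃? : {P : A → Set} → Decidable P → Dec (∃ P)
  ∃? P? = Dec.map′ (λ a → let (x , _ , px) = find a in x , px)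
                   (λ (x , px) → lose (∈-elements x) px)
                   (any? P? elements)

private
  lookup-injective : {xs : List A} → Unique xs → ∀ i j →
                     List.lookup xs i ≡ List.lookup xs j → i ≡ j
  lookup-injective (_ AllPairs.∷ _) zero    zero    _  = refl
  lookup-injective (p AllPairs.∷ _) zero    (suc j) eq =
    contradiction eq (All.lookup p (∈.∈-lookup j))
  lookup-injective (p AllPairs.∷ _) (suc i) zero    eq =
    contradiction (sym eq) (All.lookup p (∈.∈-lookup i))
  lookup-injective (_ AllPairs.∷ u) (suc i) (suc j) eq =
    cong suc (lookup-injective u i j eq)

finite-list : DecidableEquality A → (xs : List A) → (∀ x → x ∈ xs) → Finite A
finite-list _≟_ xs complete = record
  { size  = length ys
  ; index = mk↔ₛ′ (Any.index ∘ mem) (List.lookup ys)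
      (λ i → lookup-injective (Unique.deduplicate-! _≟_ xs) _ i
               (sym (Any.lookup-index (mem (List.lookup ys i)))))
      (λ x → sym (Any.lookup-index (mem x)))
  }
  where
  ys = List.deduplicate _≟_ xs
  mem : ∀ x → x ∈ ys
  mem x = ∈.∈-deduplicate⁺ _≟_ (complete x)

-- A decidable subset is finite as soon as some list covers it.
finite-refine : {P : A → Set} → DecidableEquality A → Decidable P →
                (xs : List A) → (∀ x → P x → x ∈ xs) → Finite [ x ∈ A ∣ P x ]
finite-refine {A} {P} _≟_ P? xs cover = finite-list _≟ᵣ_ (refineAll xs) complete
  where
  _≟ᵣ_ : DecidableEquality [ x ∈ A ∣ P x ]
  _≟ᵣ_ = Refinement._≟_ _≟_

  refineAll : List A → List [ x ∈ A ∣ P x ]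
  refineAll []       = []
  refineAll (x ∷ xs) with P? x
  ... | yes p = (x ,ᵣ [ p ]) ∷ refineAll xs
  ... | no  _ = refineAll xs

  ∈-refineAll : ∀ {x xs} .(p : P x) → x ∈ xs → (x ,ᵣ [ p ]) ∈ refineAll xs
  ∈-refineAll {x} p (here refl) with P? x
  ... | yes _  = here refl
  ... | no ¬p  = contradiction (recompute (P? x) p) ¬p
  ∈-refineAll {xs = y ∷ _} p (there x∈) with P? y
  ... | yes _ = there (∈-refineAll p x∈)
  ... | no  _ = ∈-refineAll p x∈

  complete : ∀ y → y ∈ refineAll xs
  complete (x ,ᵣ [ p ]) = ∈-refineAll p (cover x (recompute (P? x) p))

finite-Fin : Finite (Fin n)
finite-Fin {n} = record { size = n ; index = ↔-id (Fin n) }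

finite-⊎ : Finite A → Finite B → Finite (A ⊎ B)
finite-⊎ F G = record
  { size  = F.size + G.size
  ; index = ↔-sym Fin.+↔⊎ ↔-∘ (F.index ⊎-↔ G.index)
  }
  where module F = Finite F; module G = Finite G

finite-Σ : (a : Fin r → ℕ) → Finite (Σ[ i ∈ Fin r ] Fin (a i))
finite-Σ {r} a = finite-list (Product.≡-dec Fin._≟_ Fin._≟_)
  (List.concatMap row (allFin r))
  (λ (i , c) → ∈.∈-concatMap⁺ row (lose (∈.∈-allFin i) (∈.∈-map⁺ (i ,_) (∈.∈-allFin c))))
  where
  row : ∀ i → List (Σ[ i ∈ Fin r ] Fin (a i))
  row i = List.map (i ,_) (allFin (a i))

∃-vector? : Finite A → ∀ m (P : (Fin m → A) → Set) →
            (∀ {f g} → f ≗ g → P f → P g) → Decidable P → Dec (∃ P)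
∃-vector? F zero    P resp P? = Dec.map′ (_ ,_) (λ (_ , p) → resp (λ ()) p) (P? λ ())
∃-vector? F (suc m) P resp P? =
  Dec.map′ (λ (x , f , p) → (x Vector.∷ f) , p)
           (λ (f , p) → f zero , (f ∘ suc) , resp (λ { zero → refl ; (suc _) → refl }) p)
           (Finite.∃? F λ x → ∃-vector? F m (P ∘ (x Vector.∷_))
              (λ f≗g → resp λ { zero → refl ; (suc i) → f≗g i }) (λ f → P? (x Vector.∷ f)))

------------------------------------------------------------------------
-- Permutations

permutations : ∀ m n → List (Permutation m n)
permutations zero    zero    = Perm.id ∷ []
permutations zero    (suc n) = []
permutations (suc m) zero    = []
permutations (suc m) (suc n) =
  List.cartesianProductWith (insert 0F) (allFin (suc n)) (permutations m n)

permutations-complete : (π : Permutation m n) → Any (Perm._≈ π) (permutations m n)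
permutations-complete {zero}  {zero}  π = here λ ()
permutations-complete {zero}  {suc n} π = contradiction (π ⟨$⟩ˡ 0F) λ ()
permutations-complete {suc m} {zero}  π = contradiction (π ⟨$⟩ʳ 0F) λ ()
permutations-complete {suc m} {suc n} π =
  Any.cartesianProductWith⁺ (insert 0F) (λ { refl eq → insert-≈ eq })
    (∈.∈-allFin (π ⟨$⟩ʳ 0F)) (permutations-complete (remove 0F π))
  where
  insert-≈ : ∀ {ρ} → ρ Perm.≈ remove 0F π → insert 0F (π ⟨$⟩ʳ 0F) ρ Perm.≈ π
  insert-≈ eq zero    = refl
  insert-≈ eq (suc i) = trans (cong (Fin.punchIn (π ⟨$⟩ʳ 0F)) (eq i))
                              (insert-remove 0F π (suc i))

∃-permutation? : {P : Permutation m n → Set} →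
                 (∀ {π ρ} → π Perm.≈ ρ → P π → P ρ) → Decidable P → Dec (∃ P)
∃-permutation? resp P? =
  Dec.map′ (λ a → let (π , _ , p) = find a in π , p)
           (λ (π , p) → Any.map (λ ρ≈π → resp (λ i → sym (ρ≈π i)) p) (permutations-complete π))
           (any? P? (permutations _ _))

inversions : Permutation′ n → ℕ
inversions {n} σ = length
  (filter (λ (i , j) → (i Fin.<? j) ×-dec (σ ⟨$⟩ʳ j Fin.<? σ ⟨$⟩ʳ i))
          (List.cartesianProduct (allFin n) (allFin n)))

Even : Permutation′ n → Set
Even σ = 2 ∣ inversions σ

------------------------------------------------------------------------
-- Finite simple graphs

record Graph : Set₁ where
  field
    V      : Set
    finite : Finite V
    adj    : V → V → Bool
    adj-sym    : ∀ u v → adj u v ≡ adj v u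
    adj-irrefl : ∀ v → adj v v ≡ false

  open Finite finite public using (_≟_)

  order : ℕ
  order = Finite.size finite

  vertices : List V
  vertices = Finite.elements finite

  degree : V → ℕ
  degree v = length (filterᵇ (adj v) vertices)

open Graph using (V; order)

infix 4 _≅_

_≅_ : Graph → Graph → Set
G ≅ H = Σ[ f ∈ V G ↔ V H ] ∀ u v → Graph.adj H (to f u) (to f v) ≡ Graph.adj G u v

Connected : Graph → Set
Connected G = V G × (∀ u v → Star (λ x y → Graph.adj G x y ≡ true) u v)

SameDegreeSequence : Graph → Graph → Set
SameDegreeSequence G H =
  List.map (Graph.degree G) (Graph.vertices G) ↭ List.map (Graph.degree H) (Graph.vertices H)

_─_ : (G : Graph) → V G → Graph
G ─ v = record
  { V      = [ u ∈ V G ∣ u ≢ v ]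
  ; finite = finite-refine G._≟_ (λ u → Dec.¬? (u G.≟ v)) G.vertices
               (λ u _ → Finite.∈-elements G.finite u)
  ; adj        = λ x y → G.adj (value x) (value y)
  ; adj-sym    = λ x y → G.adj-sym (value x) (value y)
  ; adj-irrefl = λ x → G.adj-irrefl (value x)
  }
  where module G = Graph G

-- The vertex map need not be injective: vertices in a common fibre are
-- non-adjacent and have the same neighbours.
pullback : (G : Graph) → Finite A → (A → V G) → Graph
pullback {A} G finA π = record
  { V          = A
  ; finite     = finA
  ; adj        = λ x y → G.adj (π x) (π y)
  ; adj-sym    = λ x y → G.adj-sym (π x) (π y)
  ; adj-irrefl = λ x → G.adj-irrefl (π x)
  }
  where module G = Graph G

_≅?_ : ∀ G H → Dec (G ≅ H)
G ≅? H = Dec.map′ build unbuild (∃-permutation? (λ {π} {ρ} → resp {π} {ρ}) P?)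
  where
  module G = Graph G
  module H = Graph H
  gi = Finite.index G.finite
  hi = Finite.index H.finite

  P : Permutation G.order H.order → Set
  P π = ∀ i j → H.adj (from hi (π ⟨$⟩ʳ i)) (from hi (π ⟨$⟩ʳ j)) ≡ G.adj (from gi i) (from gi j)

  P? : Decidable P
  P? π = Fin.all? λ i → Fin.all? λ j → _ Bool.≟ _

  resp : ∀ {π ρ} → π Perm.≈ ρ → P π → P ρ
  resp eq p i j = trans (sym (cong₂ (λ x y → H.adj (from hi x) (from hi y)) (eq i) (eq j))) (p i j)

  build : ∃ P → G ≅ H
  build (π , p) = ↔-sym hi ↔-∘ (π ↔-∘ gi) , λ u v →
    trans (p (to gi u) (to gi v))
          (cong₂ G.adj (Inverse.strictlyInverseʳ gi u) (Inverse.strictlyInverseʳ gi v))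

  unbuild : G ≅ H → ∃ P
  unbuild (f , p) = hi ↔-∘ (f ↔-∘ ↔-sym gi) , λ i j →
    trans (cong₂ H.adj (Inverse.strictlyInverseʳ hi _) (Inverse.strictlyInverseʳ hi _))
          (p (from gi i) (from gi j))

------------------------------------------------------------------------
-- The number b(G, H) of common cards

-- The multiset intersection of the two decks has size the largest m for which
-- m distinct vertices of G and m distinct vertices of H give isomorphic cards
-- in pairs.
CommonCards : Graph → Graph → ℕ → Set
CommonCards G H m =
  Σ[ v ∈ (Fin m → V G) ] Σ[ w ∈ (Fin m → V H) ]
    (Injective _≡_ _≡_ v × Injective _≡_ _≡_ w × (∀ i → (G ─ v i) ≅ (H ─ w i)))

IsMaximum : (ℕ → Set) → ℕ → Set
IsMaximum P m = P m × (∀ j → P j → j ≤ m)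

private
  maximum : {P : ℕ → Set} → Decidable P → P 0 → ∀ N → (∀ j → P j → j ≤ N) → ∃ (IsMaximum P)
  maximum P? p₀ zero    bound = 0 , p₀ , bound
  maximum P? p₀ (suc N) bound with P? (suc N)
  ... | yes p = suc N , p , bound
  ... | no ¬p = maximum P? p₀ N λ j pj →
    ℕ.≤-pred (ℕ.≤∧≢⇒< (bound j pj) λ { refl → ¬p pj })

  injective? : Finite A → (f : Fin m → A) → Dec (Injective _≡_ _≡_ f)
  injective? F f = Dec.map′ (λ h {i} {j} → h i j) (λ h i j → h {i} {j})
    (Fin.all? λ i → Fin.all? λ j → Finite._≟_ F (f i) (f j) →-dec (i Fin.≟ j))

  injective-resp : {f g : Fin m → A} → f ≗ g → Injective _≡_ _≡_ f → Injective _≡_ _≡_ g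
  injective-resp f≗g inj {i} {j} eq = inj (trans (f≗g i) (trans eq (sym (f≗g j))))

commonCards? : ∀ G H → Decidable (CommonCards G H)
commonCards? G H m =
  ∃-vector? (Graph.finite G) m _
    (λ v≗v′ (w , iv , iw , iso) → w , injective-resp v≗v′ iv , iw ,
       λ i → subst (λ x → (G ─ x) ≅ (H ─ w i)) (v≗v′ i) (iso i))
    λ v → ∃-vector? (Graph.finite H) m _
      (λ w≗w′ (iv , iw , iso) → iv , injective-resp w≗w′ iw ,
         λ i → subst (λ y → (G ─ v i) ≅ (H ─ y)) (w≗w′ i) (iso i))
      λ w → injective? (Graph.finite G) v ×-dec (injective? (Graph.finite H) w ×-dec
              Fin.all? λ i → (G ─ v i) ≅? (H ─ w i))

maxCommonCards : ∀ G H → ∃ (IsMaximum (CommonCards G H))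
maxCommonCards G H = maximum (commonCards? G H)
  ((λ ()) , (λ ()) , (λ { {()} }) , (λ { {()} }) , λ ()) (order G)
  λ j (v , _ , inj , _) → Fin.injective⇒≤ {f = to (Finite.index (Graph.finite G)) ∘ v}
    (inj ∘ Injection.injective (↔⇒↣ (Finite.index (Graph.finite G))))

b : Graph → Graph → ℕ
b G H = proj₁ (maxCommonCards G H)

------------------------------------------------------------------------
-- Labelled graphs on [r]

-- Stored as adjacency matrices, so that propositional equality is equality
-- of labelled graphs.
IsAdjacency : Vec (Vec Bool r) r → Set
IsAdjacency M = (∀ i j → lookup (lookup M i) j ≡ lookup (lookup M j) i)
              × (∀ i → lookup (lookup M i) i ≡ false)

LabelledGraph : ℕ → Set
LabelledGraph r = [ M ∈ Vec (Vec Bool r) r ∣ IsAdjacency M ]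

edge : LabelledGraph r → Fin r → Fin r → Bool
edge F i j = lookup (lookup (value F) i) j

_≟ᴸ_ : DecidableEquality (LabelledGraph r)
_≟ᴸ_ = Refinement._≟_ (Vec.≡-dec (Vec.≡-dec Bool._≟_))

private
  matrix : (Fin r → Fin r → Bool) → Vec (Vec Bool r) r
  matrix e = Vec.tabulate λ i → Vec.tabulate (e i)

  lookup-matrix : ∀ (e : Fin r → Fin r → Bool) i j → lookup (lookup (matrix e) i) j ≡ e i j
  lookup-matrix e i j = trans (cong (λ v → lookup v j) (Vec.lookup∘tabulate _ i))
                              (Vec.lookup∘tabulate (e i) j)

  isAdjacency : {e : Fin r → Fin r → Bool} → (∀ i j → e i j ≡ e j i) → (∀ i → e i i ≡ false) →
                IsAdjacency (matrix e)
  isAdjacency {e = e} e-sym e-irrefl =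
    (λ i j → trans (lookup-matrix e i j) (trans (e-sym i j) (sym (lookup-matrix e j i)))) ,
    (λ i → trans (lookup-matrix e i i) (e-irrefl i))

labelledGraph : (e : Fin r → Fin r → Bool) →
                .(∀ i j → e i j ≡ e j i) → .(∀ i → e i i ≡ false) → LabelledGraph r
labelledGraph e e-sym e-irrefl = matrix e ,ᵣ [ isAdjacency e-sym e-irrefl ]

infixr 8 _·_

_·_ : Permutation′ r → LabelledGraph r → LabelledGraph r
σ · F@(_ ,ᵣ [ p ]) = labelledGraph (λ i j → edge F (σ ⟨$⟩ˡ i) (σ ⟨$⟩ˡ j))
                       (λ i j → proj₁ p (σ ⟨$⟩ˡ i) (σ ⟨$⟩ˡ j))
                       (λ i → proj₂ p (σ ⟨$⟩ˡ i))

EvenOrbit : LabelledGraph r → LabelledGraph r → Set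
EvenOrbit X F = ∃[ σ ] (Even σ × F ≡ σ · X)

private
  inversions-≈ : {σ τ : Permutation′ n} → σ Perm.≈ τ → inversions σ ≡ inversions τ
  inversions-≈ {n} {σ} {τ} eq = cong length
    (filter-≐ _ _
      ((λ {(i , j)} (i<j , q) → i<j , transport i j (eq i) (eq j) q) ,
       (λ {(i , j)} (i<j , q) → i<j , transport i j (sym (eq i)) (sym (eq j)) q))
      (List.cartesianProduct (allFin n) (allFin n)))
    where
    transport : ∀ i j {x y x′ y′ : Fin n} → x ≡ x′ → y ≡ y′ → y Fin.< x → y′ Fin.< x′
    transport _ _ refl refl q = q

  inverse-≈ : {σ τ : Permutation′ n} → σ Perm.≈ τ → ∀ i → σ ⟨$⟩ˡ i ≡ τ ⟨$⟩ˡ i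
  inverse-≈ {σ = σ} {τ} eq i =
    trans (cong (σ ⟨$⟩ˡ_) (sym (trans (eq (τ ⟨$⟩ˡ i)) (Perm.inverseʳ τ)))) (Perm.inverseˡ σ)

  ·-≈ : {σ τ : Permutation′ r} (F : LabelledGraph r) → σ Perm.≈ τ → σ · F ≡ τ · F
  ·-≈ {σ = σ} {τ} F eq = Refinement.value-injective
    (Vec.tabulate-cong λ i → Vec.tabulate-cong λ j →
      cong₂ (edge F) (inverse-≈ {σ = σ} {τ} eq i) (inverse-≈ {σ = σ} {τ} eq j))

evenOrbit? : (X : LabelledGraph r) → Decidable (EvenOrbit X)
evenOrbit? X F = ∃-permutation?
  (λ {σ} {τ} eq (ev , F≡) → subst (2 ∣_) (inversions-≈ {σ = σ} {τ} eq) ev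
                          , trans F≡ (·-≈ {σ = σ} {τ} X eq))
  (λ σ → (2 ∣? inversions σ) ×-dec (F ≟ᴸ (σ · X)))

finite-EvenOrbit : (X : LabelledGraph r) → Finite [ F ∈ LabelledGraph r ∣ EvenOrbit X F ]
finite-EvenOrbit {r} X = finite-refine _≟ᴸ_ (evenOrbit? X)
  (List.map (_· X) (permutations r r))
  λ { _ (σ , _ , refl) → Any.map⁺ (Any.map (λ {τ} eq → sym (·-≈ {σ = τ} {σ} X eq))
                           (permutations-complete σ)) }

------------------------------------------------------------------------
-- The seed graph

-- A labelling of [2k] by A ∪ D: inj₁ i stands for aᵢ and inj₂ i for dᵢ.
-- Everything below depends on the choice of labelling, which stays arbitrary.
Labelling : ℕ → Set
Labelling k = Fin (2 * k) ↔ (Fin k ⊎ Fin k)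

seedEdge : Fin k ⊎ Fin k → Fin k ⊎ Fin k → Bool
seedEdge (inj₁ i) (inj₁ j) = not ⌊ i Fin.≟ j ⌋
seedEdge (inj₁ i) (inj₂ j) = ⌊ i Fin.≟ j ⌋
seedEdge (inj₂ i) (inj₁ j) = ⌊ i Fin.≟ j ⌋
seedEdge (inj₂ i) (inj₂ j) = false

private
  ⌊≟⌋-sym : (_≟_ : DecidableEquality A) → ∀ x y → ⌊ x ≟ y ⌋ ≡ ⌊ y ≟ x ⌋
  ⌊≟⌋-sym _≟_ x y with x ≟ y | y ≟ x
  ... | yes _ | yes _ = refl
  ... | no  _ | no  _ = refl
  ... | yes p | no ¬q = contradiction (sym p) ¬q
  ... | no ¬p | yes q = contradiction (sym q) ¬p

  ⌊≟⌋-refl : (_≟_ : DecidableEquality A) → ∀ x → not ⌊ x ≟ x ⌋ ≡ false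
  ⌊≟⌋-refl _≟_ x with x ≟ x
  ... | yes _ = refl
  ... | no ¬p = contradiction refl ¬p

  seedEdge-sym : (x y : Fin k ⊎ Fin k) → seedEdge x y ≡ seedEdge y x
  seedEdge-sym (inj₁ i) (inj₁ j) = cong not (⌊≟⌋-sym Fin._≟_ i j)
  seedEdge-sym (inj₁ i) (inj₂ j) = ⌊≟⌋-sym Fin._≟_ i j
  seedEdge-sym (inj₂ i) (inj₁ j) = ⌊≟⌋-sym Fin._≟_ i j
  seedEdge-sym (inj₂ i) (inj₂ j) = refl

  seedEdge-irrefl : (x : Fin k ⊎ Fin k) → seedEdge x x ≡ false
  seedEdge-irrefl (inj₁ i) = ⌊≟⌋-refl Fin._≟_ i
  seedEdge-irrefl (inj₂ i) = refl

X : Labelling k → LabelledGraph (2 * k)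
X ℓ = labelledGraph (λ i j → seedEdge (to ℓ i) (to ℓ j))
        (λ i j → seedEdge-sym (to ℓ i) (to ℓ j)) (λ i → seedEdge-irrefl (to ℓ i))

𝓕 : Labelling k → Set
𝓕 {k} ℓ = [ F ∈ LabelledGraph (2 * k) ∣ EvenOrbit (X ℓ) F ]

------------------------------------------------------------------------
-- The selector and its blow-ups

-- The unordered pair {i , j} is represented by (i , j) with i < j.
Pair : ℕ → Set
Pair r = [ p ∈ Fin r × Fin r ∣ proj₁ p Fin.< proj₂ p ]

finite-Pair : Finite (Pair r)
finite-Pair {r} = finite-refine (Product.≡-dec Fin._≟_ Fin._≟_)
  (λ (i , j) → i Fin.<? j) (List.cartesianProduct (allFin r) (allFin r))
  (λ (i , j) _ → ∈.∈-cartesianProduct⁺ (∈.∈-allFin i) (∈.∈-allFin j))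

contains : Pair r → Fin r → Bool
contains ((j₁ , j₂) ,ᵣ _) i = ⌊ i Fin.≟ j₁ ⌋ ∨ ⌊ i Fin.≟ j₂ ⌋

Vertex : Labelling k → Set → Set
Vertex {k} ℓ Port = Port ⊎ (Pair (2 * k) ⊎ 𝓕 ℓ)

pattern port p = inj₁ p
pattern pair q = inj₂ (inj₁ q)
pattern sel F  = inj₂ (inj₂ F)

finite-Vertex : (ℓ : Labelling k) {Port : Set} → Finite Port → Finite (Vertex ℓ Port)
finite-Vertex ℓ P = finite-⊎ P (finite-⊎ finite-Pair (finite-EvenOrbit (X ℓ)))

S : Labelling k → Graph
S {k} ℓ = record
  { V          = Vertex ℓ (Fin (2 * k))
  ; finite     = finite-Vertex ℓ finite-Fin
  ; adj        = adj
  ; adj-sym    = adj-sym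
  ; adj-irrefl = adj-irrefl
  }
  where
  _≟ˢ_ : DecidableEquality (𝓕 ℓ)
  _≟ˢ_ = Refinement._≟_ _≟ᴸ_

  selects : 𝓕 ℓ → Pair (2 * k) → Bool
  selects F ((i , j) ,ᵣ _) = edge (value F) i j

  adj : Vertex ℓ (Fin (2 * k)) → Vertex ℓ (Fin (2 * k)) → Bool
  adj (port i) (port j)  = false
  adj (port i) (pair q)  = contains q i
  adj (port i) (sel F)   = false
  adj (pair q) (port i)  = contains q i
  adj (pair q) (pair q′) = false
  adj (pair q) (sel F)   = selects F q
  adj (sel F)  (port i)  = false
  adj (sel F)  (pair q)  = selects F q
  adj (sel F)  (sel F′)  = not ⌊ F ≟ˢ F′ ⌋

  adj-sym : ∀ u v → adj u v ≡ adj v u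
  adj-sym (port i) (port j)  = refl
  adj-sym (port i) (pair q)  = refl
  adj-sym (port i) (sel F)   = refl
  adj-sym (pair q) (port i)  = refl
  adj-sym (pair q) (pair q′) = refl
  adj-sym (pair q) (sel F)   = refl
  adj-sym (sel F)  (port i)  = refl
  adj-sym (sel F)  (pair q)  = refl
  adj-sym (sel F)  (sel F′)  = cong not (⌊≟⌋-sym _≟ˢ_ F F′)

  adj-irrefl : ∀ v → adj v v ≡ false
  adj-irrefl (port i) = refl
  adj-irrefl (pair q) = refl
  adj-irrefl (sel F)  = ⌊≟⌋-refl _≟ˢ_ F

S⟨_⟩ : Labelling k → (Fin (2 * k) → ℕ) → Graph
S⟨_⟩ {k} ℓ a = pullback (S ℓ) (finite-Vertex ℓ (finite-Σ a)) (Sum.map₁ proj₁)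

-- The index i : Fin r stands for the label toℕ i + 1.
𝐚 : ℕ → Fin r → ℕ
𝐚 t i = t + suc (toℕ i)

𝐛 : ℕ → Fin r → ℕ
𝐛 t i = t + entry (toℕ i)
  where
  entry : ℕ → ℕ
  entry 0             = 2
  entry 1             = 1
  entry (suc (suc j)) = suc (suc (suc j))

𝐆 : Labelling k → ℕ → Graph
𝐆 ℓ t = S⟨ ℓ ⟩ (𝐚 t)

𝐇 : Labelling k → ℕ → Graph
𝐇 ℓ t = S⟨ ℓ ⟩ (𝐛 t)

------------------------------------------------------------------------
-- Numerical quantities, for r = 2k.  All natural-number divisions are exact
-- and the subtractions are not truncated when k ≥ 2.

constC : ℕ → ℕ
constC k = (2 * k) C 2 + _/_ ((2 * k) !) (2 * k !) {{ℕ.m*n≢0 2 (k !) {{_}} {{k ℕ.!≢0}}}}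

orderFormula : ℕ → ℕ → ℕ
orderFormula k t = (2 * k) * t + (2 * k) * (2 * k + 1) / 2 + constC k

lowerBound : ℕ → ℕ → ℕ
lowerBound k t = (2 * k ∸ 1) * t + (2 * k) * (2 * k + 1) / 2 ∸ 1

2k≢0 : ∀ k → .{{NonTrivial k}} → NonZero (2 * k)
2k≢0 k = ℕ.m*n≢0 2 k {{_}} {{nonTrivial⇒nonZero k}}

orderFormula≢0 : ∀ k t → .{{NonTrivial k}} → NonZero (orderFormula k t)
orderFormula≢0 k t = >-nonZero (ℕ.≤-trans
  (m≥n⇒m/n>0 (ℕ.*-mono-≤ 1≤r (ℕ.+-monoˡ-≤ 1 1≤r)))
  (ℕ.≤-trans (ℕ.m≤n+m _ ((2 * k) * t)) (ℕ.m≤m+n _ (constC k))))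
  where
  1≤r : 1 ≤ 2 * k
  1≤r = >-nonZero⁻¹ (2 * k) {{2k≢0 k}}

------------------------------------------------------------------------
-- Limit inferior

-- liminf x ≥ c for a rational c, without reference to the real number liminf x.
LimInf≥ : (ℕ → ℚ) → ℚ → Set
LimInf≥ x c = ∀ ε → 0ℚ ℚ.< ε → ∃[ T ] (∀ t → T ≤ t → c ℚ.- ε ℚ.≤ x t)

{-# OPTIONS --safe #-}

-- Every automorphism of the seed X acts by the same permutation on A and on D, hence is even, so
-- the even orbit of X contains no odd image of X and has (2k)! / (2 · k!) members.  In a blow-up
-- with all classes of size at least 2 the ports are exactly the vertices with a twin, so an
-- isomorphism of blow-ups induces a permutation of [r] that preserves class sizes and maps X into
-- its even orbit; such a permutation is even, while the sizes of 𝐆 and 𝐇 only match under the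
-- transposition (1 2).  Once a port is removed from a class other than the first, two classes have
-- equal size; composing with their transposition makes the matching even, so the card is shared.
-- The degree sequences agree because the even permutations are 2-transitive on [r].
module Submission where

import Algebra.Properties.CommutativeMonoid.Sum
import Algebra.Properties.Group as Group
open import Data.Bool.Base using (Bool; true; false; not; if_then_else_)
import Data.Bool.Properties as Bool
open import Data.Empty using (⊥; ⊥-elim-irr; ⊥-elim)
open import Data.Fin.Base as Fin using (Fin; zero; suc; toℕ; punchIn; punchOut; cast; inject₁)
open import Data.Fin.Patterns using (0F; 1F; 2F; 3F)
open import Data.Fin.Permutation as Perm
  using (Permutation′; _⟨$⟩ʳ_; _⟨$⟩ˡ_; _∘ₚ_; flip; transpose; insert; remove)
open import Data.Fin.Permutation.Transposition.List
  using (TranspositionList; eval; decompose; eval-decompose)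
import Data.Fin.Properties as Fin
open import Data.Integer.Base as ℤ using (+_; -[1+_]; +<+)
import Data.Integer.Properties as ℤ
open import Data.Irrelevant using ([_])
open import Data.List.Base as List using (List; []; _∷_; length; filter; allFin; filterᵇ)
open import Data.List.Membership.Propositional using (_∈_)
import Data.List.Membership.Propositional.Properties as ∈
open import Data.List.Membership.Propositional.Properties.WithK using (unique∧set⇒bag)
import Data.List.Properties as List
open import Data.List.Relation.Binary.BagAndSetEquality using (∼bag⇒↭)
open import Data.List.Relation.Binary.Permutation.Propositional using (_↭_; ↭-trans; ↭-reflexive)
import Data.List.Relation.Binary.Permutation.Propositional.Properties as ↭
open import Data.List.Relation.Unary.Unique.Propositional using (Unique)
import Data.List.Relation.Unary.Unique.Propositional.Properties as Unique
open import Data.Nat.Base as ℕ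
  using (ℕ; zero; suc; z≤n; s≤s; _+_; s<s; z<s; _*_; _!; _≤_; _∸_; NonZero; NonTrivial)
open import Data.Nat.Combinatorics using (_C_; nCk+nC[k+1]≡[n+1]C[k+1]; nC1≡n)
open import Data.Nat.Coprimality using (Coprime)
open import Data.Nat.DivMod as ℕ using (m*n/n≡m)
open import Data.Nat.Divisibility using (_∣_; divides; _∣0)
import Data.Nat.Properties as ℕ
open import Data.Nat.Solver using (module +-*-Solver)
open import Data.Parity.Base as ℙ using (Parity; 0ℙ; 1ℙ)
import Data.Parity.Properties as ℙ
open import Data.Product.Base using (∃-syntax; _×_; _,_; proj₁; proj₂; Σ-syntax)
open import Data.Product.Function.NonDependent.Propositional using (_×-↔_)
open import Data.Rational.Base as ℚ using (ℚ; mkℚ; 1ℚ; _-_; _/_; *<*)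
import Data.Rational.Properties as ℚ
open import Data.Rational.Unnormalised.Base as ℚᵘ using (mkℚᵘ; *≤*)
import Data.Rational.Unnormalised.Properties as ℚᵘ
open import Data.Refinement using (value) renaming (_,_ to _,ᵣ_)
import Data.Refinement.Properties as Refinement
open import Data.Sum.Base as Sum using (_⊎_; inj₁; inj₂)
open import Data.Sum.Function.Propositional using (_⊎-↔_)
open import Data.Sum.Properties using (inj₁-injective; inj₂-injective)
open import Data.Unit.Base using (⊤; tt)
import Data.Vec.Base as Vec
import Data.Vec.Properties as Vec
open import Defs
open import Function.Base using (_∘_; id)
open import Function.Bundles using (Injection; _↔_; Inverse; mk↔ₛ′; mk⇔)
open import Function.Construct.Composition using (_↔-∘_)
open import Function.Construct.Identity using (↔-id)
open import Function.Construct.Symmetry using (↔-sym)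
open import Function.Properties.Inverse using (↔⇒↣)
open import Relation.Binary.Construct.Closure.ReflexiveTransitive
  using (Star; ε; _◅_; _◅◅_; reverse)
open import Relation.Binary.Definitions using (tri<; tri≈; tri>; DecidableEquality)
open import Relation.Binary.PropositionalEquality
  using (_≡_; _≢_; _≗_; refl; sym; trans; cong; cong₂; subst; module ≡-Reasoning)
open import Relation.Nullary using (Dec; does; yes; no; contradiction; ¬_)
open import Relation.Nullary.Decidable
  using (dec-true; dec-false; _×-dec_; ⌊_⌋; recompute; isYes≗does)
open import Relation.Unary using (Decidable)

open Inverse using (to; from; strictlyInverseˡ; strictlyInverseʳ)
open Graph using (V; adj; adj-sym; adj-irrefl)

-- The seed is chosen for the parity of its stabiliser: a symmetry acts once on A and once on D, so
-- its sign counts twice and vanishes, and an even and an odd permutation never give the same image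
-- of the seed. The family of selectors thereby records an orientation of the labels, while the
-- distinct class sizes pin each label down. The first class contributes no cards because every
-- other class is preceded by a class exactly one smaller, and the first is not. What remains
-- uncounted are its t + 1 ports and the C pairs and selectors; since n is at least rt, the share of
-- these is asymptotically at most 1/r. For the degree sequences no isomorphism is available, so one
-- bijection matches the vertices, and the two degrees are then compared by an auxiliary bijection
-- that may differ from vertex to vertex. Signs take values in the group of order two, where the
-- number of inversions becomes a double sum that a permutation can reindex.

private
  variable
    A B : Set
    k m n r : ℕ

-- The sign of a permutation

module ∑ℙ = Algebra.Properties.CommutativeMonoid.Sum ℙ.+-0-commutativeMonoid

∑² : (Fin n → Fin n → Parity) → Parity
∑² f = ∑ℙ.sum λ i → ∑ℙ.sum (f i)

∑²-cong : {f g : Fin n → Fin n → Parity} → (∀ i j → f i j ≡ g i j) → ∑² f ≡ ∑² g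
∑²-cong f≗g = ∑ℙ.sum-cong-≗ λ i → ∑ℙ.sum-cong-≗ (f≗g i)

∑²-+ : (f g : Fin n → Fin n → Parity) → ∑² (λ i j → f i j ℙ.+ g i j) ≡ ∑² f ℙ.+ ∑² g
∑²-+ f g = trans (∑ℙ.sum-cong-≗ λ i → ∑ℙ.∑-distrib-+ (f i) (g i)) (∑ℙ.∑-distrib-+ (λ i → ∑ℙ.sum (f i)) (λ i → ∑ℙ.sum (g i)))

∑²-permute : (f : Fin n → Fin n → Parity) (π : Permutation′ n) →
             ∑² f ≡ ∑² (λ i j → f (π ⟨$⟩ʳ i) (π ⟨$⟩ʳ j))
∑²-permute f π = trans (∑ℙ.sum-permute _ π)
  (∑ℙ.sum-cong-≗ λ i → ∑ℙ.sum-permute (f (π ⟨$⟩ʳ i)) π)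

-- Off the diagonal the terms come in equal pairs, which cancel modulo 2. The induction strips the
-- first row and the first column, which have the same sum.
∑²-symmetric : (h : Fin n → Fin n → Parity) → (∀ i j → h i j ≡ h j i) → (∀ i → h i i ≡ 0ℙ) →
               ∑² h ≡ 0ℙ
∑²-symmetric {zero}  h h-sym h-diag = refl
∑²-symmetric {suc n} h h-sym h-diag = begin
  (h 0F 0F ℙ.+ row₀) ℙ.+ ∑ℙ.sum (λ i → h (suc i) 0F ℙ.+ rows i)
    ≡⟨ cong₂ (λ x y → (x ℙ.+ row₀) ℙ.+ y) (h-diag 0F) (∑ℙ.∑-distrib-+ _ rows) ⟩
  row₀ ℙ.+ (∑ℙ.sum (λ i → h (suc i) 0F) ℙ.+ ∑ℙ.sum rows)
    ≡⟨ cong₂ (λ x y → row₀ ℙ.+ (x ℙ.+ y)) (∑ℙ.sum-cong-≗ λ i → h-sym (suc i) 0F)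
         (∑²-symmetric (λ i j → h (suc i) (suc j)) (λ i j → h-sym _ _) (λ i → h-diag _)) ⟩
  row₀ ℙ.+ (row₀ ℙ.+ 0ℙ)
    ≡⟨ cong (row₀ ℙ.+_) (ℙ.+-identityʳ row₀) ⟩
  row₀ ℙ.+ row₀
    ≡⟨ ℙ.p+p≡0ℙ row₀ ⟩
  0ℙ ∎
  where
  open ≡-Reasoning
  row₀ = ∑ℙ.sum λ j → h 0F (suc j)
  rows : Fin n → Parity
  rows i = ∑ℙ.sum λ j → h (suc i) (suc j)

⟦_⟧ : Bool → Parity
⟦ b ⟧ = if b then 1ℙ else 0ℙ

∑ℙ-list : {A : Set} → (A → Parity) → List A → Parity
∑ℙ-list f = List.foldr (λ x p → f x ℙ.+ p) 0ℙ

∑ℙ-list-++ : {A : Set} (f : A → Parity) (xs ys : List A) →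
             ∑ℙ-list f (xs List.++ ys) ≡ ∑ℙ-list f xs ℙ.+ ∑ℙ-list f ys
∑ℙ-list-++ f []       ys = refl
∑ℙ-list-++ f (x ∷ xs) ys =
  trans (cong (f x ℙ.+_) (∑ℙ-list-++ f xs ys)) (sym (ℙ.+-assoc (f x) _ _))

∑ℙ-list-map : {A B : Set} (f : B → Parity) (g : A → B) (xs : List A) →
              ∑ℙ-list f (List.map g xs) ≡ ∑ℙ-list (f ∘ g) xs
∑ℙ-list-map f g []       = refl
∑ℙ-list-map f g (x ∷ xs) = cong (f (g x) ℙ.+_) (∑ℙ-list-map f g xs)

∑ℙ-list-tabulate : {A : Set} (f : A → Parity) (g : Fin n → A) →
                   ∑ℙ-list f (List.tabulate g) ≡ ∑ℙ.sum (f ∘ g)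
∑ℙ-list-tabulate {zero}  f g = refl
∑ℙ-list-tabulate {suc n} f g = cong (f (g 0F) ℙ.+_) (∑ℙ-list-tabulate f (g ∘ suc))

∑ℙ-list-cartesianProduct : {A B : Set} (f : A × B → Parity) (xs : List A) (ys : List B) →
  ∑ℙ-list f (List.cartesianProduct xs ys) ≡ ∑ℙ-list (λ x → ∑ℙ-list (λ y → f (x , y)) ys) xs
∑ℙ-list-cartesianProduct f []       ys = refl
∑ℙ-list-cartesianProduct f (x ∷ xs) ys =
  trans (∑ℙ-list-++ f (List.map (x ,_) ys) _)
        (cong₂ ℙ._+_ (∑ℙ-list-map f (x ,_) ys) (∑ℙ-list-cartesianProduct f xs ys))

parity-suc : ∀ n → ℕ.parity (suc n) ≡ 1ℙ ℙ.+ ℕ.parity n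
parity-suc n = sym (trans (cong ℙ._⁻¹ (sym (ℙ.suc-homo-⁻¹ n))) (ℙ.⁻¹-involutive _))

parity-length-filter : {A : Set} {P : A → Set} (P? : Decidable P) (xs : List A) →
  ℕ.parity (length (filter P? xs)) ≡ ∑ℙ-list (λ x → ⟦ does (P? x) ⟧) xs
parity-length-filter P? []       = refl
parity-length-filter P? (x ∷ xs) with does (P? x)
... | true  = trans (parity-suc (length (filter P? xs))) (cong (1ℙ ℙ.+_) (parity-length-filter P? xs))
... | false = parity-length-filter P? xs

parity≡0⇒2∣ : ∀ m → ℕ.parity m ≡ 0ℙ → 2 ∣ m
parity≡0⇒2∣ zero          eq = 2 ∣0
parity≡0⇒2∣ (suc (suc m)) eq with parity≡0⇒2∣ m eq
... | divides q refl = divides (suc q) refl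

opaque
  -- A value in the group of order two rather than a divisibility statement, so that composition
  -- becomes addition. Opaque, because later arguments need only its algebraic laws and never the
  -- list of inversions.
  sgn : Permutation′ n → Parity
  sgn σ = ℕ.parity (inversions σ)

  even⇒sgn : {σ : Permutation′ n} → Even σ → sgn σ ≡ 0ℙ
  even⇒sgn (divides q eq) = trans (cong ℕ.parity eq) (trans (ℙ.*-homo-* q 2) (ℙ.*-zeroʳ (ℕ.parity q)))

  sgn⇒even : {σ : Permutation′ n} → sgn σ ≡ 0ℙ → Even σ
  sgn⇒even {σ = σ} = parity≡0⇒2∣ (inversions σ)

  sgn≡parity : (σ : Permutation′ n) → sgn σ ≡ ℕ.parity (inversions σ)
  sgn≡parity σ = refl

_<ℙ_ : Fin n → Fin n → Parity
i <ℙ j = ⟦ does (i Fin.<? j) ⟧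

-- Summing over all ordered pairs, with the condition `i <ℙ j` as a factor, gives an expression that
-- can be reindexed by any permutation.
sgn-∑² : (σ : Permutation′ n) → sgn σ ≡ ∑² λ i j → (i <ℙ j) ℙ.* ((σ ⟨$⟩ʳ j) <ℙ (σ ⟨$⟩ʳ i))
sgn-∑² {n} σ = begin
  sgn σ
    ≡⟨ sgn≡parity σ ⟩
  ℕ.parity (inversions σ)
    ≡⟨ parity-length-filter _ (List.cartesianProduct (allFin n) (allFin n)) ⟩
  ∑ℙ-list (λ p → inv (proj₁ p) (proj₂ p)) (List.cartesianProduct (allFin n) (allFin n))
    ≡⟨ ∑ℙ-list-cartesianProduct (λ p → inv (proj₁ p) (proj₂ p)) (allFin n) (allFin n) ⟩
  ∑ℙ-list (λ i → ∑ℙ-list (inv i) (allFin n)) (allFin n)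
    ≡⟨ ∑ℙ-list-tabulate (λ i → ∑ℙ-list (inv i) (allFin n)) (λ i → i) ⟩
  ∑ℙ.sum (λ i → ∑ℙ-list (inv i) (allFin n))
    ≡⟨ ∑ℙ.sum-cong-≗ (λ i → ∑ℙ-list-tabulate (inv i) (λ j → j)) ⟩
  ∑² inv
    ≡⟨ ∑²-cong {f = inv} (λ i j → ⟦∧⟧ (does (i Fin.<? j)) (does (σ ⟨$⟩ʳ j Fin.<? σ ⟨$⟩ʳ i))) ⟩
  ∑² (λ i j → (i <ℙ j) ℙ.* ((σ ⟨$⟩ʳ j) <ℙ (σ ⟨$⟩ʳ i))) ∎
  where
  open ≡-Reasoning
  inv : Fin n → Fin n → Parity
  inv i j = ⟦ does ((i Fin.<? j) ×-dec (σ ⟨$⟩ʳ j Fin.<? σ ⟨$⟩ʳ i)) ⟧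

  ⟦∧⟧ : ∀ a b → ⟦ a Data.Bool.Base.∧ b ⟧ ≡ ⟦ a ⟧ ℙ.* ⟦ b ⟧
  ⟦∧⟧ true  b = refl
  ⟦∧⟧ false b = refl

sgn-cong : {σ τ : Permutation′ n} → σ Perm.≈ τ → sgn σ ≡ sgn τ
sgn-cong {σ = σ} {τ} σ≈τ = begin
  sgn σ ≡⟨ sgn-∑² σ ⟩
  _     ≡⟨ ∑²-cong (λ i j → cong₂ (λ x y → (i <ℙ j) ℙ.* (x <ℙ y)) (σ≈τ j) (σ≈τ i)) ⟩
  _     ≡⟨ sgn-∑² τ ⟨
  sgn τ ∎
  where open ≡-Reasoning

<ℙ-irrefl : (i : Fin n) → i <ℙ i ≡ 0ℙ
<ℙ-irrefl i = cong ⟦_⟧ (dec-false (i Fin.<? i) (Fin.<-irrefl refl))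

<ℙ-flip : {i j : Fin n} → i ≢ j → j <ℙ i ≡ (i <ℙ j) ℙ.⁻¹
<ℙ-flip {i = i} {j} i≢j with Fin.<-cmp i j
... | tri≈ _ i≡j _     = contradiction i≡j i≢j
... | tri< i<j _ j≮i = trans (cong ⟦_⟧ (dec-false (j Fin.<? i) j≮i))
                             (cong (ℙ._⁻¹ ∘ ⟦_⟧) (sym (dec-true (i Fin.<? j) i<j)))
... | tri> i≮j _ j<i = trans (cong ⟦_⟧ (dec-true (j Fin.<? i) j<i))
                             (cong (ℙ._⁻¹ ∘ ⟦_⟧) (sym (dec-false (i Fin.<? j) i≮j)))

⟨$⟩ʳ-injective : (σ : Permutation′ n) {i j : Fin n} → σ ⟨$⟩ʳ i ≡ σ ⟨$⟩ʳ j → i ≡ j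
⟨$⟩ʳ-injective σ = Injection.injective (↔⇒↣ σ)

-- The inversions of σ ∘ₚ τ are, modulo 2, those of σ and the preimages of those of τ: the
-- difference h is symmetric in i and j, so it cancels in the sum over all ordered pairs.
sgn-∘ : (σ τ : Permutation′ n) → sgn (σ ∘ₚ τ) ≡ sgn σ ℙ.+ sgn τ
sgn-∘ {n} σ τ = begin
  sgn (σ ∘ₚ τ)              ≡⟨ sgn-∑² (σ ∘ₚ τ) ⟩
  ∑² inv-στ                 ≡⟨ cancel (∑² inv-στ) (∑² inv-σ ℙ.+ ∑² inv-τ) sum≡0 ⟩
  ∑² inv-σ ℙ.+ ∑² inv-τ     ≡⟨ cong (∑² inv-σ ℙ.+_) (∑²-permute _ σ) ⟨
  ∑² inv-σ ℙ.+ _            ≡⟨ cong₂ ℙ._+_ (sgn-∑² σ) (sgn-∑² τ) ⟨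
  sgn σ ℙ.+ sgn τ           ∎
  where
  open ≡-Reasoning
  σʳ = σ ⟨$⟩ʳ_
  τʳ = τ ⟨$⟩ʳ_

  inv-στ inv-σ inv-τ h : Fin n → Fin n → Parity
  inv-στ i j = (i <ℙ j) ℙ.* (τʳ (σʳ j) <ℙ τʳ (σʳ i))
  inv-σ  i j = (i <ℙ j) ℙ.* (σʳ j <ℙ σʳ i)
  inv-τ  i j = (σʳ i <ℙ σʳ j) ℙ.* (τʳ (σʳ j) <ℙ τʳ (σʳ i))
  h i j = inv-στ i j ℙ.+ (inv-σ i j ℙ.+ inv-τ i j)

  cancel : ∀ p q → p ℙ.+ q ≡ 0ℙ → p ≡ q
  cancel p q eq = ℙ.+-cancelʳ-≡ q p q (trans eq (sym (ℙ.p+p≡0ℙ q)))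

  -- `x`, `y`, `z` tell whether i lies below j originally, after `σ`, and after `σ` and `τ`.
  -- Exchanging i and j complements all three, and the expression does not change.
  identity : ∀ x y z → (x ℙ.* z ℙ.⁻¹) ℙ.+ ((x ℙ.* y ℙ.⁻¹) ℙ.+ (y ℙ.* z ℙ.⁻¹)) ≡
                       (x ℙ.⁻¹ ℙ.* z) ℙ.+ ((x ℙ.⁻¹ ℙ.* y) ℙ.+ (y ℙ.⁻¹ ℙ.* z))
  identity 0ℙ 0ℙ 0ℙ = refl
  identity 0ℙ 0ℙ 1ℙ = refl
  identity 0ℙ 1ℙ 0ℙ = refl
  identity 0ℙ 1ℙ 1ℙ = refl
  identity 1ℙ 0ℙ 0ℙ = refl
  identity 1ℙ 0ℙ 1ℙ = refl
  identity 1ℙ 1ℙ 0ℙ = refl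
  identity 1ℙ 1ℙ 1ℙ = refl

  h-sym : ∀ i j → h i j ≡ h j i
  h-sym i j with i Fin.≟ j
  ... | yes refl = refl
  ... | no i≢j
    rewrite <ℙ-flip i≢j | <ℙ-flip (i≢j ∘ ⟨$⟩ʳ-injective σ)
          | <ℙ-flip (i≢j ∘ ⟨$⟩ʳ-injective σ ∘ ⟨$⟩ʳ-injective τ) =
    identity (i <ℙ j) (σʳ i <ℙ σʳ j) (τʳ (σʳ i) <ℙ τʳ (σʳ j))

  h-diag : ∀ i → h i i ≡ 0ℙ
  h-diag i rewrite <ℙ-irrefl i | <ℙ-irrefl (σʳ i) = refl

  sum≡0 : ∑² inv-στ ℙ.+ (∑² inv-σ ℙ.+ ∑² inv-τ) ≡ 0ℙ
  sum≡0 = trans (cong (∑² inv-στ ℙ.+_) (sym (∑²-+ inv-σ inv-τ)))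
         (trans (sym (∑²-+ inv-στ _)) (∑²-symmetric h h-sym h-diag))

sgn-id : sgn (Perm.id {n}) ≡ 0ℙ
sgn-id {n} = ℙ.+-cancelˡ-≡ (sgn (Perm.id {n})) _ _ (trans
  (trans (sym (sgn-∘ (Perm.id {n}) Perm.id)) (sgn-cong {σ = Perm.id ∘ₚ Perm.id} {Perm.id {n}} λ _ → refl))
  (sym (ℙ.+-identityʳ _)))

sgn-flip : (σ : Permutation′ n) → sgn (flip σ) ≡ sgn σ
sgn-flip σ = ℙ.+-cancelˡ-≡ (sgn σ) _ _ (begin
  sgn σ ℙ.+ sgn (flip σ) ≡⟨ sgn-∘ σ (flip σ) ⟨
  sgn (σ ∘ₚ flip σ)      ≡⟨ sgn-cong {σ = σ ∘ₚ flip σ} {Perm.id} (λ i → Perm.inverseˡ σ) ⟩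
  sgn (Perm.id {_})      ≡⟨ sgn-id ⟩
  0ℙ                     ≡⟨ ℙ.p+p≡0ℙ (sgn σ) ⟨
  sgn σ ℙ.+ sgn σ        ∎)
  where open ≡-Reasoning

-- Transpositions

transpose-first : (i j : Fin n) → transpose i j ⟨$⟩ʳ i ≡ j
transpose-first i j rewrite dec-true (i Fin.≟ i) refl = refl

transpose-second : (i j : Fin n) → transpose i j ⟨$⟩ʳ j ≡ i
transpose-second i j with j Fin.≟ i
... | yes j≡i = j≡i
... | no  _ rewrite dec-true (j Fin.≟ j) refl = refl

transpose-other : {i j x : Fin n} → x ≢ i → x ≢ j → transpose i j ⟨$⟩ʳ x ≡ x
transpose-other {i = i} {j} {x} x≢i x≢j
  rewrite dec-false (x Fin.≟ i) x≢i | dec-false (x Fin.≟ j) x≢j = refl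

transpose-injective : {f : Fin m → Fin n} → (∀ {x y} → f x ≡ f y → x ≡ y) → ∀ i j x →
                      transpose (f i) (f j) ⟨$⟩ʳ f x ≡ f (transpose i j ⟨$⟩ʳ x)
transpose-injective {f = f} inj i j x with x Fin.≟ i
... | yes refl = transpose-first (f i) (f j)
... | no x≢i with x Fin.≟ j
...   | yes refl = transpose-second (f i) (f j)
...   | no x≢j   = transpose-other (x≢i ∘ inj) (x≢j ∘ inj)

transpose-same : (i x : Fin n) → transpose i i ⟨$⟩ʳ x ≡ x
transpose-same i x with x Fin.≟ i
... | yes x≡i = sym x≡i
... | no x≢i rewrite dec-false (x Fin.≟ i) x≢i = refl

-- The pair (0, 1) is the only inversion, and for 0 and 1 as literals nearly every term of the
-- double sum computes. All other transpositions are reduced to this one by conjugation.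
sgn-transpose-01 : sgn (transpose {suc (suc n)} 0F 1F) ≡ 1ℙ
sgn-transpose-01 {n} = begin
  sgn t                                       ≡⟨ sgn-∑² t ⟩
  ∑² inv                                      ≡⟨ cong₂ ℙ._+_ (cong (λ x → 0ℙ ℙ.+ (1ℙ ℙ.+ x)) (∑-zero {n} λ j → refl))
                                                  (cong₂ ℙ._+_ (∑-zero {suc (suc n)} {inv 1F} row₁)
                                                    (∑-zero {n} λ i → ∑-zero {suc (suc n)} {inv (suc (suc i))} (rest i))) ⟩
  1ℙ ∎
  where
  open ≡-Reasoning
  t = transpose {suc (suc n)} 0F 1F
  inv : Fin (suc (suc n)) → Fin (suc (suc n)) → Parity
  inv i j = (i <ℙ j) ℙ.* ((t ⟨$⟩ʳ j) <ℙ (t ⟨$⟩ʳ i))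

  ∑-zero : ∀ {m} {f : Fin m → Parity} → (∀ i → f i ≡ 0ℙ) → ∑ℙ.sum f ≡ 0ℙ
  ∑-zero {m} f≡0 = trans (∑ℙ.sum-cong-≗ f≡0) (∑ℙ.sum-replicate-zero m)

  row₁ : ∀ j → inv 1F j ≡ 0ℙ
  row₁ 0F = refl
  row₁ 1F = refl
  row₁ (suc (suc j)) = refl

  rest : ∀ i j → inv (suc (suc i)) j ≡ 0ℙ
  rest i 0F = refl
  rest i 1F = refl
  rest i (suc (suc j)) with i Fin.≟ j
  ... | yes refl rewrite <ℙ-irrefl i = refl
  ... | no i≢j = trans (cong ((i <ℙ j) ℙ.*_) (<ℙ-flip i≢j)) (ℙ.p*p⁻¹≡0ℙ (i <ℙ j))

opaque
  -- Carries 0 to `i` and 1 to `j`. The first factor moves 1 to the point that the second factor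
  -- sends to `j`; it leaves 0 alone because that point is 0 only if `i` and `j` coincide.
  to-01 : (i j : Fin (suc (suc n))) → Permutation′ (suc (suc n))
  to-01 i j = transpose 1F (transpose 0F i ⟨$⟩ˡ j) ∘ₚ transpose 0F i

  to-01-0F : {i j : Fin (suc (suc n))} → i ≢ j → to-01 i j ⟨$⟩ʳ 0F ≡ i
  to-01-0F {i = i} {j} i≢j = trans
    (cong (transpose 0F i ⟨$⟩ʳ_) (transpose-other {i = 1F} {transpose 0F i ⟨$⟩ˡ j} {0F} (λ ()) λ eq →
      i≢j (trans (sym (transpose-first 0F i))
        (trans (cong (transpose 0F i ⟨$⟩ʳ_) eq) (Perm.inverseʳ (transpose 0F i) {j})))))
    (transpose-first 0F i)

  to-01-1F : (i j : Fin (suc (suc n))) → to-01 i j ⟨$⟩ʳ 1F ≡ j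
  to-01-1F i j = trans
    (cong (transpose 0F i ⟨$⟩ʳ_) (transpose-first 1F (transpose 0F i ⟨$⟩ˡ j)))
    (Perm.inverseʳ (transpose 0F i) {j})

-- Conjugation by `to-01 i j` gives the transposition of 0 and 1, and the sign of the conjugating
-- permutation occurs twice.
sgn-transpose : {i j : Fin n} → i ≢ j → sgn (transpose i j) ≡ 1ℙ
sgn-transpose {suc zero}    {0F} {0F} i≢j = contradiction refl i≢j
sgn-transpose {suc (suc n)} {i}  {j}  i≢j = begin
  sgn (transpose i j)              ≡⟨ sgn-cong {σ = transpose i j} {flip π ∘ₚ t ∘ₚ π} conj ⟩
  sgn (flip π ∘ₚ t ∘ₚ π)           ≡⟨ sgn-∘ (flip π) (t ∘ₚ π) ⟩
  sgn (flip π) ℙ.+ sgn (t ∘ₚ π)    ≡⟨ cong₂ ℙ._+_ (sgn-flip π) (trans (sgn-∘ t π) (cong (ℙ._+ sgn π) sgn-transpose-01)) ⟩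
  sgn π ℙ.+ sgn π ℙ.⁻¹             ≡⟨ ℙ.p+p⁻¹≡1ℙ (sgn π) ⟩
  1ℙ                               ∎
  where
  open ≡-Reasoning
  t = transpose {suc (suc n)} 0F 1F
  π = to-01 i j
  conj : ∀ x → transpose i j ⟨$⟩ʳ x ≡ π ⟨$⟩ʳ (t ⟨$⟩ʳ (π ⟨$⟩ˡ x))
  conj x = begin
    transpose i j ⟨$⟩ʳ x
      ≡⟨ cong₂ (λ a b → transpose a b ⟨$⟩ʳ x) (to-01-0F i≢j) (to-01-1F i j) ⟨
    transpose (π ⟨$⟩ʳ 0F) (π ⟨$⟩ʳ 1F) ⟨$⟩ʳ x
      ≡⟨ cong (transpose (π ⟨$⟩ʳ 0F) (π ⟨$⟩ʳ 1F) ⟨$⟩ʳ_) (Perm.inverseʳ π) ⟨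
    transpose (π ⟨$⟩ʳ 0F) (π ⟨$⟩ʳ 1F) ⟨$⟩ʳ (π ⟨$⟩ʳ (π ⟨$⟩ˡ x))
      ≡⟨ transpose-injective (⟨$⟩ʳ-injective π) 0F 1F (π ⟨$⟩ˡ x) ⟩
    π ⟨$⟩ʳ (t ⟨$⟩ʳ (π ⟨$⟩ˡ x)) ∎

-- If the obvious permutation is odd, the transposition of 2 and 3 repairs it.
even-2-transitive : 4 ℕ.≤ n → {i j i′ j′ : Fin n} → i ≢ j → i′ ≢ j′ →
  ∃[ σ ] (sgn σ ≡ 0ℙ × σ ⟨$⟩ʳ i ≡ i′ × σ ⟨$⟩ʳ j ≡ j′)
even-2-transitive {suc (suc (suc (suc n)))} (s≤s (s≤s (s≤s (s≤s z≤n)))) {i} {j} {i′} {j′} i≢j i′≢j′ = by-sign (sgn π) refl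
  where
  α = to-01 i j
  β = to-01 i′ j′
  π = flip α ∘ₚ β
  t = transpose {suc (suc (suc (suc n)))} 2F 3F
  π′ = flip α ∘ₚ t ∘ₚ β

  α⁻¹i : α ⟨$⟩ˡ i ≡ 0F
  α⁻¹i = trans (cong (α ⟨$⟩ˡ_) (sym (to-01-0F i≢j))) (Perm.inverseˡ α)
  α⁻¹j : α ⟨$⟩ˡ j ≡ 1F
  α⁻¹j = trans (cong (α ⟨$⟩ˡ_) (sym (to-01-1F i j))) (Perm.inverseˡ α)

  by-sign : ∀ p → sgn π ≡ p → ∃[ σ ] (sgn σ ≡ 0ℙ × σ ⟨$⟩ʳ i ≡ i′ × σ ⟨$⟩ʳ j ≡ j′)
  by-sign 0ℙ eq = π , eq , trans (cong (β ⟨$⟩ʳ_) α⁻¹i) (to-01-0F i′≢j′)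
                         , trans (cong (β ⟨$⟩ʳ_) α⁻¹j) (to-01-1F i′ j′)
  by-sign 1ℙ eq = π′ , sgn-π′
    , trans (cong (λ x → β ⟨$⟩ʳ (t ⟨$⟩ʳ x)) α⁻¹i) (to-01-0F i′≢j′)
    , trans (cong (λ x → β ⟨$⟩ʳ (t ⟨$⟩ʳ x)) α⁻¹j) (to-01-1F i′ j′)
    where
    open ≡-Reasoning
    sgn-π′ : sgn π′ ≡ 0ℙ
    sgn-π′ = begin
      sgn π′                                     ≡⟨ sgn-∘ (flip α) (t ∘ₚ β) ⟩
      sgn (flip α) ℙ.+ sgn (t ∘ₚ β)              ≡⟨ cong (sgn (flip α) ℙ.+_) (sgn-∘ t β) ⟩
      sgn (flip α) ℙ.+ (sgn t ℙ.+ sgn β)         ≡⟨ cong (λ x → sgn (flip α) ℙ.+ (x ℙ.+ sgn β)) (sgn-transpose {i = 2F} {3F} λ ()) ⟩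
      sgn (flip α) ℙ.+ sgn β ℙ.⁻¹                ≡⟨ rearrange (sgn (flip α)) (sgn β) ⟩
      (sgn (flip α) ℙ.+ sgn β) ℙ.⁻¹              ≡⟨ cong ℙ._⁻¹ (trans (sym (sgn-∘ (flip α) β)) eq) ⟩
      0ℙ                                         ∎
      where
      rearrange : ∀ p q → p ℙ.+ q ℙ.⁻¹ ≡ (p ℙ.+ q) ℙ.⁻¹
      rearrange 0ℙ q = refl
      rearrange 1ℙ q = refl

third : 3 ℕ.≤ n → (i j : Fin n) → ∃[ l ] (l ≢ i × l ≢ j)
third (s≤s (s≤s (s≤s z≤n))) 0F            0F            = 1F , (λ ()) , (λ ())
third (s≤s (s≤s (s≤s z≤n))) 0F            1F            = 2F , (λ ()) , (λ ())
third (s≤s (s≤s (s≤s z≤n))) 0F            (suc (suc _)) = 1F , (λ ()) , (λ ())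
third (s≤s (s≤s (s≤s z≤n))) 1F            0F            = 2F , (λ ()) , (λ ())
third (s≤s (s≤s (s≤s z≤n))) 1F            (suc _)       = 0F , (λ ()) , (λ ())
third (s≤s (s≤s (s≤s z≤n))) (suc (suc _)) 0F            = 1F , (λ ()) , (λ ())
third (s≤s (s≤s (s≤s z≤n))) (suc (suc _)) (suc _)       = 0F , (λ ()) , (λ ())

-- Bijections of finite types

to-injective : (f : A ↔ B) {x y : A} → to f x ≡ to f y → x ≡ y
to-injective f = Injection.injective (↔⇒↣ f)

size-↔ : (F : Finite A) (G : Finite B) → A ↔ B → Finite.size F ≡ Finite.size G
size-↔ F G f = Perm.↔⇒≡ (Finite.index G ↔-∘ (f ↔-∘ ↔-sym (Finite.index F)))

elements-unique : (F : Finite A) → Unique (Finite.elements F)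
elements-unique F = Unique.map⁺ (to-injective (↔-sym (Finite.index F))) (Unique.allFin⁺ _)

-- Both lists are free of duplicates and contain every element of `B`, and such lists agree up to
-- order.
elements-↭ : (F : Finite A) (G : Finite B) (f : A ↔ B) →
             List.map (to f) (Finite.elements F) ↭ Finite.elements G
elements-↭ F G f = ∼bag⇒↭ (unique∧set⇒bag
  (Unique.map⁺ (to-injective f) (elements-unique F)) (elements-unique G)
  (λ {x} → mk⇔ (λ _ → Finite.∈-elements G x)
     (λ _ → subst (_∈ List.map (to f) (Finite.elements F)) (strictlyInverseˡ f x)
              (∈.∈-map⁺ (to f) (Finite.∈-elements F (from f x))))))

length-filterᵇ-map : (p : B → Bool) (f : A → B) (xs : List A) →
                     length (filterᵇ p (List.map f xs)) ≡ length (filterᵇ (p ∘ f) xs)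
length-filterᵇ-map p f []       = refl
length-filterᵇ-map p f (x ∷ xs) with p (f x)
... | true  = cong suc (length-filterᵇ-map p f xs)
... | false = length-filterᵇ-map p f xs

length-filterᵇ-cong : {p q : A → Bool} → p ≗ q → (xs : List A) →
                      length (filterᵇ p xs) ≡ length (filterᵇ q xs)
length-filterᵇ-cong         p≗q []       = refl
length-filterᵇ-cong {p = p} {q} p≗q (x ∷ xs) with p x | q x | p≗q x
... | true  | .true  | refl = cong suc (length-filterᵇ-cong p≗q xs)
... | false | .false | refl = length-filterᵇ-cong p≗q xs

module _ {G H : Graph} where
  private
    module G = Graph G
    module H = Graph H

  -- The bijection only has to respect the neighbourhood of the one vertex `u`. It may therefore be
  -- chosen anew for every vertex, even between graphs that are not isomorphic.
  degree-cong : (f : V G ↔ V H) (u : V G) (v : V H) →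
                (∀ x → G.adj u x ≡ H.adj v (to f x)) → G.degree u ≡ H.degree v
  degree-cong f u v eq = begin
    length (filterᵇ (G.adj u) G.vertices)                       ≡⟨ length-filterᵇ-cong eq G.vertices ⟩
    length (filterᵇ (H.adj v ∘ to f) G.vertices)                ≡⟨ length-filterᵇ-map (H.adj v) (to f) G.vertices ⟨
    length (filterᵇ (H.adj v) (List.map (to f) G.vertices))     ≡⟨ ↭.↭-length (↭.filter-↭ (Bool.T? ∘ H.adj v) (elements-↭ G.finite H.finite f)) ⟩
    length (filterᵇ (H.adj v) H.vertices)                       ∎
    where open ≡-Reasoning

  sameDegreeSequence : (f : V G ↔ V H) → (∀ u → G.degree u ≡ H.degree (to f u)) →
                       SameDegreeSequence G H
  sameDegreeSequence f eq = ↭-trans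
    (↭-reflexive (trans (List.map-cong eq G.vertices) (List.map-∘ G.vertices)))
    (↭.map⁺ H.degree (elements-↭ G.finite H.finite f))

  -- Adjacencies at `v` itself are not constrained, so `f` may be a bijection that fails to be an
  -- isomorphism only there.
  ─-≅ : (f : V G ↔ V H) (v : V G) →
        (∀ x y → x ≢ v → y ≢ v → H.adj (to f x) (to f y) ≡ G.adj x y) → (G ─ v) ≅ (H ─ to f v)
  ─-≅ f v adj-f = mk↔ₛ′ to′ from′
      (λ (x ,ᵣ _) → Refinement.value-injective (strictlyInverseˡ f x))
      (λ (x ,ᵣ _) → Refinement.value-injective (strictlyInverseʳ f x))
    , λ { (x ,ᵣ [ x≢v ]) (y ,ᵣ [ y≢v ]) →
          adj-f x y (λ eq → ⊥-elim-irr (x≢v eq)) (λ eq → ⊥-elim-irr (y≢v eq)) }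
    where
    to′ : V (G ─ v) → V (H ─ to f v)
    to′ (x ,ᵣ [ x≢v ]) = to f x ,ᵣ [ x≢v ∘ to-injective f ]
    from′ : V (H ─ to f v) → V (G ─ v)
    from′ (y ,ᵣ [ y≢fv ]) = from f y ,ᵣ [ (λ eq → y≢fv (trans (sym (strictlyInverseˡ f y)) (cong (to f) eq))) ]

-- Unordered pairs

∈⇒contains : (q : Pair r) {i : Fin r} →
             i ≡ proj₁ (value q) ⊎ i ≡ proj₂ (value q) → contains q i ≡ true
∈⇒contains q {i} (inj₁ refl)
  rewrite isYes≗does (i Fin.≟ i) | dec-true (i Fin.≟ i) refl = refl
∈⇒contains q {i} (inj₂ refl)
  rewrite isYes≗does (i Fin.≟ i) | dec-true (i Fin.≟ i) refl = Bool.∨-zeroʳ _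

contains⇒∈ : (q : Pair r) {i : Fin r} →
             contains q i ≡ true → i ≡ proj₁ (value q) ⊎ i ≡ proj₂ (value q)
contains⇒∈ ((j₁ , j₂) ,ᵣ _) {i} eq with i Fin.≟ j₁ | i Fin.≟ j₂
... | yes i≡j₁ | _        = inj₁ i≡j₁
... | no _     | yes i≡j₂ = inj₂ i≡j₂

proj₁≢proj₂ : (q : Pair r) → proj₁ (value q) ≢ proj₂ (value q)
proj₁≢proj₂ (_ ,ᵣ [ p ]) refl = ⊥-elim-irr (Fin.<-irrefl refl p)

⁅_,_⁆ : (i j : Fin r) → .(i ≢ j) → Pair r
⁅ i , j ⁆ i≢j with Fin.<-cmp i j
... | tri< i<j _ _   = (i , j) ,ᵣ [ i<j ]
... | tri≈ _ i≡j _   = ⊥-elim-irr (i≢j i≡j)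
... | tri> _ _ j<i   = (j , i) ,ᵣ [ j<i ]

-- Two distinct labels fill both places of a pair, and the ordering of the places excludes the
-- crossed cases.
pair-unique : {q q′ : Pair r} (i j : Fin r) → i ≢ j →
  contains q i ≡ true → contains q j ≡ true → contains q′ i ≡ true → contains q′ j ≡ true → q ≡ q′
pair-unique {q = q@((_ , _) ,ᵣ [ p ])} {q′@((_ , _) ,ᵣ [ p′ ])} i j i≢j qi qj q′i q′j
  with contains⇒∈ q {i} qi | contains⇒∈ q {j} qj | contains⇒∈ q′ {i} q′i | contains⇒∈ q′ {j} q′j
... | inj₁ refl | inj₁ refl | _ | _ = contradiction refl i≢j
... | inj₂ refl | inj₂ refl | _ | _ = contradiction refl i≢j
... | inj₁ _ | inj₂ _ | inj₁ refl | inj₁ refl = contradiction refl i≢j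
... | inj₁ _ | inj₂ _ | inj₂ refl | inj₂ refl = contradiction refl i≢j
... | inj₂ _ | inj₁ _ | inj₁ refl | inj₁ refl = contradiction refl i≢j
... | inj₂ _ | inj₁ _ | inj₂ refl | inj₂ refl = contradiction refl i≢j
... | inj₁ refl | inj₂ refl | inj₁ refl | inj₂ refl = refl
... | inj₁ refl | inj₂ refl | inj₂ refl | inj₁ refl = ⊥-elim-irr (Fin.<-asym p p′)
... | inj₂ refl | inj₁ refl | inj₁ refl | inj₂ refl = ⊥-elim-irr (Fin.<-asym p p′)
... | inj₂ refl | inj₁ refl | inj₂ refl | inj₁ refl = refl

contains-fst : (q : Pair r) → contains q (proj₁ (value q)) ≡ true
contains-fst q = ∈⇒contains q (inj₁ refl)

contains-snd : (q : Pair r) → contains q (proj₂ (value q)) ≡ true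
contains-snd q = ∈⇒contains q (inj₂ refl)

∈-⁅⁆ : (i j : Fin r) .(i≢j : i ≢ j) {l : Fin r} → l ≡ i ⊎ l ≡ j → contains (⁅ i , j ⁆ i≢j) l ≡ true
∈-⁅⁆ i j i≢j l∈ with Fin.<-cmp i j
... | tri< i<j _ _   = ∈⇒contains ((i , j) ,ᵣ [ i<j ]) l∈
... | tri≈ _ i≡j _   = ⊥-elim-irr (i≢j i≡j)
... | tri> _ _ j<i   = ∈⇒contains ((j , i) ,ᵣ [ j<i ]) (Sum.swap l∈)

∈-⁅⁆⁻¹ : (i j : Fin r) .(i≢j : i ≢ j) {l : Fin r} → contains (⁅ i , j ⁆ i≢j) l ≡ true → l ≡ i ⊎ l ≡ j
∈-⁅⁆⁻¹ i j i≢j l∈ with Fin.<-cmp i j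
... | tri< i<j _ _   = contains⇒∈ ((i , j) ,ᵣ [ i<j ]) l∈
... | tri≈ _ i≡j _   = ⊥-elim-irr (i≢j i≡j)
... | tri> _ _ j<i   = Sum.swap (contains⇒∈ ((j , i) ,ᵣ [ j<i ]) l∈)

infixr 8 _·ₚ_

_·ₚ_ : Permutation′ r → Pair r → Pair r
σ ·ₚ q = ⁅ σ ⟨$⟩ʳ proj₁ (value q) , σ ⟨$⟩ʳ proj₂ (value q) ⁆ (proj₁≢proj₂ q ∘ to-injective σ)

true-⇔ : {a b : Bool} → (a ≡ true → b ≡ true) → (b ≡ true → a ≡ true) → a ≡ b
true-⇔ {true}  {b}     f g = sym (f refl)
true-⇔ {false} {true}  f g = g refl
true-⇔ {false} {false} f g = refl

contains-·ₚ : (σ : Permutation′ r) (q : Pair r) (i : Fin r) →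
              contains (σ ·ₚ q) (σ ⟨$⟩ʳ i) ≡ contains q i
contains-·ₚ σ q i = true-⇔
  (λ eq → ∈⇒contains q (Sum.map (to-injective σ) (to-injective σ)
            (∈-⁅⁆⁻¹ _ _ (proj₁≢proj₂ q ∘ to-injective σ) eq)))
  (λ eq → ∈-⁅⁆ _ _ (proj₁≢proj₂ q ∘ to-injective σ)
            (Sum.map (cong (σ ⟨$⟩ʳ_)) (cong (σ ⟨$⟩ʳ_)) (contains⇒∈ q eq)))

contains-·ₚ-flip : (σ τ : Permutation′ r) → (∀ i → τ ⟨$⟩ʳ (σ ⟨$⟩ʳ i) ≡ i) → (q : Pair r) (i : Fin r) →
                   contains q i ≡ true → contains (τ ·ₚ σ ·ₚ q) i ≡ true
contains-·ₚ-flip σ τ inv q i eq = begin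
  contains (τ ·ₚ σ ·ₚ q) i                             ≡⟨ cong (contains (τ ·ₚ σ ·ₚ q)) (inv i) ⟨
  contains (τ ·ₚ σ ·ₚ q) (τ ⟨$⟩ʳ (σ ⟨$⟩ʳ i))           ≡⟨ contains-·ₚ τ (σ ·ₚ q) (σ ⟨$⟩ʳ i) ⟩
  contains (σ ·ₚ q) (σ ⟨$⟩ʳ i)                         ≡⟨ contains-·ₚ σ q i ⟩
  contains q i                                         ≡⟨ eq ⟩
  true                                                 ∎
  where open ≡-Reasoning

·ₚ-inverse : (σ τ : Permutation′ r) → (∀ i → τ ⟨$⟩ʳ (σ ⟨$⟩ʳ i) ≡ i) → (q : Pair r) → τ ·ₚ σ ·ₚ q ≡ q
·ₚ-inverse σ τ inv q = pair-unique (proj₁ (value q)) (proj₂ (value q)) (proj₁≢proj₂ q)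
  (contains-·ₚ-flip σ τ inv q (proj₁ (value q)) (contains-fst q)) (contains-·ₚ-flip σ τ inv q (proj₂ (value q)) (contains-snd q))
  (contains-fst q) (contains-snd q)

pair↔ : Permutation′ r → Pair r ↔ Pair r
pair↔ σ = mk↔ₛ′ (σ ·ₚ_) (flip σ ·ₚ_)
  (·ₚ-inverse (flip σ) σ (λ _ → Perm.inverseʳ σ)) (·ₚ-inverse σ (flip σ) (λ _ → Perm.inverseˡ σ))

pair-suc↔ : Pair (suc r) ↔ (Fin r ⊎ Pair r)
pair-suc↔ {r} = mk↔ₛ′ to′ from′
  (λ { (inj₁ j) → refl ; (inj₂ ((i , j) ,ᵣ p)) → refl })
  (λ { ((zero , zero) ,ᵣ [ p ]) → ⊥-elim-irr (ℕ.n≮0 p)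
     ; ((zero , suc j) ,ᵣ p) → refl
     ; ((suc i , zero) ,ᵣ [ p ]) → ⊥-elim-irr (ℕ.n≮0 p)
     ; ((suc i , suc j) ,ᵣ p) → refl })
  where
  to′ : Pair (suc r) → Fin r ⊎ Pair r
  to′ ((zero , zero) ,ᵣ [ p ])   = ⊥-elim-irr (ℕ.n≮0 p)
  to′ ((zero , suc j) ,ᵣ _)      = inj₁ j
  to′ ((suc i , zero) ,ᵣ [ p ])  = ⊥-elim-irr (ℕ.n≮0 p)
  to′ ((suc i , suc j) ,ᵣ [ p ]) = inj₂ ((i , j) ,ᵣ [ ℕ.s<s⁻¹ p ])
  from′ : Fin r ⊎ Pair r → Pair (suc r)
  from′ (inj₁ j)                  = (zero , suc j) ,ᵣ [ z<s ]
  from′ (inj₂ ((i , j) ,ᵣ [ p ])) = (suc i , suc j) ,ᵣ [ s<s p ]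

-- Pascal's rule: a pair either contains the label 0, with `r` choices for its partner, or is a pair
-- of the remaining labels.
finite-pairs : ∀ r → Σ[ F ∈ Finite (Pair r) ] Finite.size F ≡ r C 2
finite-pairs zero = record { size = 0 ; index = mk↔ₛ′ (λ ()) (λ ()) (λ ()) (λ ()) } , refl
finite-pairs (suc r) with finite-pairs r
... | F , eq = record
  { size  = r + Finite.size F
  ; index = ↔-sym Fin.+↔⊎ ↔-∘ ((↔-id (Fin r) ⊎-↔ Finite.index F) ↔-∘ pair-suc↔)
  } , trans (cong₂ _+_ (sym (nC1≡n r)) eq) (nCk+nC[k+1]≡[n+1]C[k+1] r 1)

-- The enumeration in `finite-Pair` filters and removes duplicates, so its length is obtained by
-- comparison with an enumeration built for counting.
size-Pair : ∀ r → Finite.size (finite-Pair {r}) ≡ r C 2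
size-Pair r = let (F , eq) = finite-pairs r in trans (size-↔ finite-Pair F (↔-id (Pair r))) eq

-- Labelled graphs

edge-sym : (F : LabelledGraph r) → ∀ i j → edge F i j ≡ edge F j i
edge-sym (_ ,ᵣ [ p ]) i j = recompute (_ Bool.≟ _) (proj₁ p i j)

edge-irrefl : (F : LabelledGraph r) → ∀ i → edge F i i ≡ false
edge-irrefl (_ ,ᵣ [ p ]) i = recompute (_ Bool.≟ _) (proj₂ p i)

edge-ext : {F F′ : LabelledGraph r} → (∀ i j → edge F i j ≡ edge F′ i j) → F ≡ F′
edge-ext {F = M ,ᵣ _} {M′ ,ᵣ _} eq = Refinement.value-injective
  (vec-ext λ i → vec-ext λ j → eq i j)
  where
  vec-ext : {A : Set} {n : ℕ} {xs ys : Vec.Vec A n} → (∀ i → Vec.lookup xs i ≡ Vec.lookup ys i) → xs ≡ ys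
  vec-ext {xs = xs} {ys} eq = trans (sym (Vec.tabulate∘lookup xs))
    (trans (Vec.tabulate-cong eq) (Vec.tabulate∘lookup ys))

edge-labelledGraph : (e : Fin r → Fin r → Bool) .(e-sym : ∀ i j → e i j ≡ e j i)
  .(e-irrefl : ∀ i → e i i ≡ false) → ∀ i j → edge (labelledGraph e e-sym e-irrefl) i j ≡ e i j
edge-labelledGraph e _ _ i j = trans (cong (λ v → Vec.lookup v j) (Vec.lookup∘tabulate _ i))
                                     (Vec.lookup∘tabulate (e i) j)

edge-· : (σ : Permutation′ r) (F : LabelledGraph r) →
         ∀ i j → edge (σ · F) i j ≡ edge F (σ ⟨$⟩ˡ i) (σ ⟨$⟩ˡ j)
edge-· σ F@(_ ,ᵣ [ p ]) = edge-labelledGraph (λ i j → edge F (σ ⟨$⟩ˡ i) (σ ⟨$⟩ˡ j))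
  (λ i j → proj₁ p (σ ⟨$⟩ˡ i) (σ ⟨$⟩ˡ j)) (λ i → proj₂ p (σ ⟨$⟩ˡ i))

edge-·-⟨$⟩ʳ : (σ : Permutation′ r) (F : LabelledGraph r) →
              ∀ i j → edge (σ · F) (σ ⟨$⟩ʳ i) (σ ⟨$⟩ʳ j) ≡ edge F i j
edge-·-⟨$⟩ʳ σ F i j = trans (edge-· σ F _ _) (cong₂ (edge F) (Perm.inverseˡ σ) (Perm.inverseˡ σ))

-- Characterises `σ · F` by the forward direction of `σ` alone; the laws of the action follow from
-- it without handling inverses.
·-unique : (σ : Permutation′ r) (F : LabelledGraph r) {F′ : LabelledGraph r} →
           (∀ i j → edge F′ (σ ⟨$⟩ʳ i) (σ ⟨$⟩ʳ j) ≡ edge F i j) → F′ ≡ σ · F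
·-unique σ F {F′} eq = edge-ext λ i j → begin
  edge F′ i j                                              ≡⟨ cong₂ (edge F′) (Perm.inverseʳ σ) (Perm.inverseʳ σ) ⟨
  edge F′ (σ ⟨$⟩ʳ (σ ⟨$⟩ˡ i)) (σ ⟨$⟩ʳ (σ ⟨$⟩ˡ j))          ≡⟨ eq (σ ⟨$⟩ˡ i) (σ ⟨$⟩ˡ j) ⟩
  edge F (σ ⟨$⟩ˡ i) (σ ⟨$⟩ˡ j)                             ≡⟨ edge-· σ F i j ⟨
  edge (σ · F) i j                                         ∎
  where open ≡-Reasoning

·-∘ : (σ τ : Permutation′ r) (F : LabelledGraph r) → (σ ∘ₚ τ) · F ≡ τ · σ · F
·-∘ σ τ F = sym (·-unique (σ ∘ₚ τ) F λ i j → trans (edge-·-⟨$⟩ʳ τ (σ · F) _ _) (edge-·-⟨$⟩ʳ σ F i j))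

·-cong : {σ τ : Permutation′ r} (F : LabelledGraph r) → σ Perm.≈ τ → σ · F ≡ τ · F
·-cong {σ = σ} {τ} F σ≈τ = ·-unique τ F λ i j →
  trans (cong₂ (edge (σ · F)) (sym (σ≈τ i)) (sym (σ≈τ j))) (edge-·-⟨$⟩ʳ σ F i j)

·-id : (F : LabelledGraph r) → Perm.id · F ≡ F
·-id F = sym (·-unique Perm.id F λ i j → refl)

·-flip : (σ : Permutation′ r) (F : LabelledGraph r) → flip σ · σ · F ≡ F
·-flip σ F = trans (sym (·-∘ σ (flip σ) F))
  (trans (·-cong {σ = σ ∘ₚ flip σ} {Perm.id} F (λ _ → Perm.inverseˡ σ)) (·-id F))

edgeAt : LabelledGraph r → Pair r → Bool
edgeAt F q = edge F (proj₁ (value q)) (proj₂ (value q))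

edgeAt-⁅⁆ : (F : LabelledGraph r) (i j : Fin r) .(i≢j : i ≢ j) → edgeAt F (⁅ i , j ⁆ i≢j) ≡ edge F i j
edgeAt-⁅⁆ F i j i≢j with Fin.<-cmp i j
... | tri< i<j _ _   = refl
... | tri≈ _ i≡j _   = ⊥-elim-irr (i≢j i≡j)
... | tri> _ _ j<i   = edge-sym F j i

edgeAt-· : (σ : Permutation′ r) (F : LabelledGraph r) (q : Pair r) → edgeAt (σ · F) (σ ·ₚ q) ≡ edgeAt F q
edgeAt-· σ F q = trans (edgeAt-⁅⁆ (σ · F) _ _ (proj₁≢proj₂ q ∘ to-injective σ)) (edge-·-⟨$⟩ʳ σ F _ _)

-- The even orbit

EvenOrbit-· : {F₀ F : LabelledGraph r} (ρ : Permutation′ r) → sgn ρ ≡ 0ℙ →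
              EvenOrbit F₀ F → EvenOrbit F₀ (ρ · F)
EvenOrbit-· {F₀ = F₀} ρ even-ρ (σ , even-σ , refl) =
  σ ∘ₚ ρ , sgn⇒even {σ = σ ∘ₚ ρ} (trans (sgn-∘ σ ρ) (cong₂ ℙ._+_ (even⇒sgn {σ = σ} even-σ) even-ρ)) , sym (·-∘ σ ρ F₀)

-- Evenness enters here: signs add, so an even `ρ` keeps images of the seed inside the even orbit
-- and thus permutes the selectors.
𝓕↔ : (ℓ : Labelling k) (ρ : Permutation′ (2 ℕ.* k)) → sgn ρ ≡ 0ℙ → 𝓕 ℓ ↔ 𝓕 ℓ
𝓕↔ ℓ ρ even-ρ = mk↔ₛ′
  (λ { (F ,ᵣ [ o ]) → ρ · F ,ᵣ [ EvenOrbit-· {F₀ = X ℓ} {F} ρ even-ρ o ] })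
  (λ { (F ,ᵣ [ o ]) → flip ρ · F ,ᵣ [ EvenOrbit-· {F₀ = X ℓ} {F} (flip ρ) (trans (sgn-flip ρ) even-ρ) o ] })
  (λ F → Refinement.value-injective (·-flip (flip ρ) (value F)))
  (λ F → Refinement.value-injective (·-flip ρ (value F)))

-- Automorphisms of the seed graph

⌊⌋-injective : (_≟ᴬ_ : DecidableEquality A) (_≟ᴮ_ : DecidableEquality B) (f : A → B) →
               (∀ {x y} → f x ≡ f y → x ≡ y) → ∀ x y → ⌊ f x ≟ᴮ f y ⌋ ≡ ⌊ x ≟ᴬ y ⌋
⌊⌋-injective _≟ᴬ_ _≟ᴮ_ f inj x y with x ≟ᴬ y | f x ≟ᴮ f y
... | yes _    | yes _  = refl
... | no _     | no _   = refl
... | yes refl | no ¬eq = contradiction refl ¬eq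
... | no x≢y   | yes eq = contradiction (inj eq) x≢y

⌊≟⌋⇒≡ : (i j : Fin n) → ⌊ i Fin.≟ j ⌋ ≡ true → i ≡ j
⌊≟⌋⇒≡ i j eq with i Fin.≟ j
... | yes i≡j = i≡j

≡⇒⌊≟⌋ : (i : Fin n) → ⌊ i Fin.≟ i ⌋ ≡ true
≡⇒⌊≟⌋ i with i Fin.≟ i
... | yes _   = refl
... | no i≢i = contradiction refl i≢i

seedEdge-≢ : {i j : Fin k} → i ≢ j → seedEdge (inj₁ i) (inj₁ j) ≡ true
seedEdge-≢ {i = i} {j} i≢j with i Fin.≟ j
... | yes i≡j = contradiction i≡j i≢j
... | no _    = refl

seedEdge-D : {m : Fin k} (u : Fin k ⊎ Fin k) → seedEdge (inj₂ m) u ≡ true → u ≡ inj₁ m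
seedEdge-D {m = m} (inj₁ i) eq = cong inj₁ (sym (⌊≟⌋⇒≡ m i eq))

seedEdge-map : (ρ : Permutation′ k) (u v : Fin k ⊎ Fin k) →
  seedEdge (Sum.map (to ρ) (to ρ) u) (Sum.map (to ρ) (to ρ) v) ≡ seedEdge u v
seedEdge-map ρ (inj₁ i) (inj₁ j) = cong not (⌊⌋-injective Fin._≟_ Fin._≟_ (to ρ) (to-injective ρ) i j)
seedEdge-map ρ (inj₁ i) (inj₂ j) = ⌊⌋-injective Fin._≟_ Fin._≟_ (to ρ) (to-injective ρ) i j
seedEdge-map ρ (inj₂ i) (inj₁ j) = ⌊⌋-injective Fin._≟_ Fin._≟_ (to ρ) (to-injective ρ) i j
seedEdge-map ρ (inj₂ i) (inj₂ j) = refl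

module _ {k : ℕ} where
  private
    Label : Set
    Label = Fin (suc (suc k)) ⊎ Fin (suc (suc k))

  SeedAutomorphism : Label ↔ Label → Set
  SeedAutomorphism α = ∀ u v → seedEdge (to α u) (to α v) ≡ seedEdge u v

  SeedAutomorphism-sym : (α : Label ↔ Label) → SeedAutomorphism α → SeedAutomorphism (↔-sym α)
  SeedAutomorphism-sym α aut u v = trans (sym (aut _ _))
    (cong₂ seedEdge (strictlyInverseˡ α u) (strictlyInverseˡ α v))

  another : (i : Fin (suc (suc k))) → ∃[ j ] i ≢ j
  another 0F      = 1F , λ ()
  another (suc i) = 0F , λ ()

  -- A vertex of A has two neighbours, a vertex of D only one.
  A→A : (α : Label ↔ Label) → SeedAutomorphism α → ∀ i → ∃[ j ] to α (inj₁ i) ≡ inj₁ j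
  A→A α aut i with to α (inj₁ i) in eq
  ... | inj₁ j = j , refl
  ... | inj₂ m = contradiction
      (to-injective α (trans (neighbour (inj₂ i) (≡⇒⌊≟⌋ i))
        (sym (neighbour (inj₁ (proj₁ (another i))) (seedEdge-≢ (proj₂ (another i)))))))
      λ ()
    where
    neighbour : ∀ u → seedEdge (inj₁ i) u ≡ true → to α u ≡ inj₁ m
    neighbour u i~u = seedEdge-D (to α u)
      (trans (cong (λ x → seedEdge x (to α u)) (sym eq)) (trans (aut (inj₁ i) u) i~u))

  -- Applied to `α` and to its inverse, `A→A` yields a permutation of A and forbids that a vertex of
  -- D enters A. The image of dᵢ is then the unique neighbour in D of the image of aᵢ, so D is
  -- permuted in the same way.
  seedAutomorphism : (α : Label ↔ Label) → SeedAutomorphism α → ∃[ ρ ] (∀ u → to α u ≡ Sum.map (to ρ) (to ρ) u)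
  seedAutomorphism α aut = ρ , on-both
    where
    α⁻¹ = ↔-sym α
    aut⁻¹ = SeedAutomorphism-sym α aut

    ρ : Permutation′ (suc (suc k))
    ρ = mk↔ₛ′ (proj₁ ∘ A→A α aut) (proj₁ ∘ A→A α⁻¹ aut⁻¹)
      (λ i → let (j , eq) = A→A α⁻¹ aut⁻¹ i in inj₁-injective
         (trans (sym (proj₂ (A→A α aut j))) (trans (cong (to α) (sym eq)) (strictlyInverseˡ α (inj₁ i)))))
      (λ i → let (j , eq) = A→A α aut i in inj₁-injective
         (trans (sym (proj₂ (A→A α⁻¹ aut⁻¹ j))) (trans (cong (from α) (sym eq)) (strictlyInverseʳ α (inj₁ i)))))

    on-both : ∀ u → to α u ≡ Sum.map (to ρ) (to ρ) u
    on-both (inj₁ i) = proj₂ (A→A α aut i)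
    on-both (inj₂ i) with to α (inj₂ i) in eq
    ... | inj₁ m = contradiction
      (trans (sym (proj₂ (A→A α⁻¹ aut⁻¹ m))) (trans (cong (from α) (sym eq)) (strictlyInverseʳ α (inj₂ i))))
      λ ()
    ... | inj₂ m = cong inj₂ (sym (⌊≟⌋⇒≡ _ _
      (trans (sym (cong₂ seedEdge (proj₂ (A→A α aut i)) eq)) (trans (aut (inj₁ i) (inj₂ i)) (≡⇒⌊≟⌋ i)))))

edge-X : (ℓ : Labelling k) → ∀ i j → edge (X ℓ) i j ≡ seedEdge (to ℓ i) (to ℓ j)
edge-X ℓ i j = trans (cong (λ v → Vec.lookup v j) (Vec.lookup∘tabulate _ i)) (Vec.lookup∘tabulate _ j)

diagonal : Labelling k → Permutation′ k → Permutation′ (2 * k)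
diagonal ℓ ρ = ↔-sym ℓ ↔-∘ ((ρ ⊎-↔ ρ) ↔-∘ ℓ)

diagonal-∘ : (ℓ : Labelling k) (ρ τ : Permutation′ k) →
             diagonal ℓ (ρ ∘ₚ τ) Perm.≈ diagonal ℓ ρ ∘ₚ diagonal ℓ τ
diagonal-∘ ℓ ρ τ x = cong (from ℓ) (trans (map-∘ (to ℓ x)) (cong (Sum.map (to τ) (to τ)) (sym (strictlyInverseˡ ℓ _))))
  where
  map-∘ : ∀ u → Sum.map (to τ ∘ to ρ) (to τ ∘ to ρ) u ≡ Sum.map (to τ) (to τ) (Sum.map (to ρ) (to ρ) u)
  map-∘ (inj₁ _) = refl
  map-∘ (inj₂ _) = refl

diagonal-cong : (ℓ : Labelling k) (ρ τ : Permutation′ k) → ρ Perm.≈ τ → diagonal ℓ ρ Perm.≈ diagonal ℓ τ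
diagonal-cong ℓ ρ τ ρ≈τ x = cong (from ℓ) (map-cong (to ℓ x))
  where
  map-cong : ∀ u → Sum.map (to ρ) (to ρ) u ≡ Sum.map (to τ) (to τ) u
  map-cong (inj₁ i) = cong inj₁ (ρ≈τ i)
  map-cong (inj₂ i) = cong inj₂ (ρ≈τ i)

diagonal-injective : (ℓ : Labelling k) (ρ τ : Permutation′ k) → diagonal ℓ ρ Perm.≈ diagonal ℓ τ → ρ Perm.≈ τ
diagonal-injective ℓ ρ τ eq i = inj₁-injective (trans (sym (at ρ)) (trans (cong (to ℓ) (eq (from ℓ (inj₁ i)))) (at τ)))
  where
  at : ∀ π → to ℓ (to (diagonal ℓ π) (from ℓ (inj₁ i))) ≡ inj₁ (to π i)
  at π = trans (strictlyInverseˡ ℓ _) (cong (Sum.map (to π) (to π)) (strictlyInverseˡ ℓ (inj₁ i)))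

diagonal-X : (ℓ : Labelling k) (ρ : Permutation′ k) → diagonal ℓ ρ · X ℓ ≡ X ℓ
diagonal-X ℓ ρ = sym (·-unique (diagonal ℓ ρ) (X ℓ) λ i j → begin
  edge (X ℓ) (to δ i) (to δ j)                                  ≡⟨ edge-X ℓ _ _ ⟩
  seedEdge (to ℓ (to δ i)) (to ℓ (to δ j))                      ≡⟨ cong₂ seedEdge (strictlyInverseˡ ℓ _) (strictlyInverseˡ ℓ _) ⟩
  seedEdge (Sum.map (to ρ) (to ρ) (to ℓ i)) (Sum.map (to ρ) (to ρ) (to ℓ j)) ≡⟨ seedEdge-map ρ (to ℓ i) (to ℓ j) ⟩
  seedEdge (to ℓ i) (to ℓ j)                                    ≡⟨ edge-X ℓ i j ⟨
  edge (X ℓ) i j                                                ∎)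
  where
  open ≡-Reasoning
  δ = diagonal ℓ ρ

-- The permutation is the product of the transpositions of aᵢ, aⱼ and of dᵢ, dⱼ, which have equal
-- signs. The case i = j is included because a list of transpositions may contain trivial ones.
sgn-diagonal-transpose : (ℓ : Labelling k) (i j : Fin k) → sgn (diagonal ℓ (transpose i j)) ≡ 0ℙ
sgn-diagonal-transpose {k} ℓ i j = begin
  sgn (diagonal ℓ (transpose i j)) ≡⟨ sgn-cong {σ = diagonal ℓ (transpose i j)} {tA ∘ₚ tD} split ⟩
  sgn (tA ∘ₚ tD)                   ≡⟨ sgn-∘ tA tD ⟩
  sgn tA ℙ.+ sgn tD                ≡⟨ cong (ℙ._+ sgn tD) same-sign ⟩
  sgn tD ℙ.+ sgn tD                ≡⟨ ℙ.p+p≡0ℙ (sgn tD) ⟩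
  0ℙ                               ∎
  where
  open ≡-Reasoning
  a d : Fin k → Fin (2 * k)
  a = from ℓ ∘ inj₁
  d = from ℓ ∘ inj₂
  a-injective : ∀ {x y} → a x ≡ a y → x ≡ y
  a-injective = inj₁-injective ∘ to-injective (↔-sym ℓ)
  d-injective : ∀ {x y} → d x ≡ d y → x ≡ y
  d-injective = inj₂-injective ∘ to-injective (↔-sym ℓ)
  a≢d : ∀ {x y} → a x ≢ d y
  a≢d eq with () ← to-injective (↔-sym ℓ) eq
  tA = transpose (a i) (a j)
  tD = transpose (d i) (d j)

  on-labels : ∀ u → from ℓ (Sum.map (to (transpose i j)) (to (transpose i j)) u) ≡ to tD (to tA (from ℓ u))
  on-labels (inj₁ x) = sym (trans (cong (to tD) (transpose-injective a-injective i j x))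
                                  (transpose-other a≢d a≢d))
  on-labels (inj₂ x) = sym (trans (cong (to tD) (transpose-other (a≢d ∘ sym) (a≢d ∘ sym)))
                                  (transpose-injective d-injective i j x))

  split : diagonal ℓ (transpose i j) Perm.≈ tA ∘ₚ tD
  split x = trans (on-labels (to ℓ x)) (cong (to tD ∘ to tA) (strictlyInverseʳ ℓ x))

  sgn-trivial : ∀ {n} (x : Fin n) → sgn (transpose x x) ≡ 0ℙ
  sgn-trivial x = trans (sgn-cong {σ = transpose x x} {Perm.id} (transpose-same x)) sgn-id

  same-sign : sgn tA ≡ sgn tD
  same-sign with i Fin.≟ j
  ... | yes refl = trans (sgn-trivial (a i)) (sym (sgn-trivial (d i)))
  ... | no i≢j   = trans (sgn-transpose (i≢j ∘ a-injective)) (sym (sgn-transpose (i≢j ∘ d-injective)))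

-- `diagonal` respects composition, so a decomposition of `ρ` into transpositions reduces the claim
-- to a single one.
sgn-diagonal : (ℓ : Labelling k) (ρ : Permutation′ k) → sgn (diagonal ℓ ρ) ≡ 0ℙ
sgn-diagonal {k} ℓ ρ = trans
  (sgn-cong {σ = diagonal ℓ ρ} {diagonal ℓ (eval (decompose ρ))}
    (diagonal-cong ℓ ρ (eval (decompose ρ)) λ i → sym (eval-decompose ρ i)))
  (on-list (decompose ρ))
  where
  open ≡-Reasoning
  on-list : (ts : TranspositionList k) → sgn (diagonal ℓ (eval ts)) ≡ 0ℙ
  on-list [] = trans (sgn-cong {σ = diagonal ℓ Perm.id} {Perm.id} λ x →
    trans (cong (from ℓ) (map-id (to ℓ x))) (strictlyInverseʳ ℓ x)) sgn-id
    where
    map-id : ∀ (u : Fin k ⊎ Fin k) → Sum.map id id u ≡ u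
    map-id (inj₁ _) = refl
    map-id (inj₂ _) = refl
  on-list ((i , j) ∷ ts) = begin
    sgn (diagonal ℓ (transpose i j ∘ₚ eval ts))
      ≡⟨ sgn-cong {σ = diagonal ℓ (transpose i j ∘ₚ eval ts)} {diagonal ℓ (transpose i j) ∘ₚ diagonal ℓ (eval ts)}
           (diagonal-∘ ℓ (transpose i j) (eval ts)) ⟩
    sgn (diagonal ℓ (transpose i j) ∘ₚ diagonal ℓ (eval ts))
      ≡⟨ sgn-∘ (diagonal ℓ (transpose i j)) (diagonal ℓ (eval ts)) ⟩
    sgn (diagonal ℓ (transpose i j)) ℙ.+ sgn (diagonal ℓ (eval ts))
      ≡⟨ cong₂ ℙ._+_ (sgn-diagonal-transpose ℓ i j) (on-list ts) ⟩
    0ℙ ∎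

stabilizer-X : (ℓ : Labelling (suc (suc k))) (σ : Permutation′ (2 * suc (suc k))) →
               σ · X ℓ ≡ X ℓ → ∃[ ρ ] σ Perm.≈ diagonal ℓ ρ
stabilizer-X ℓ σ eq =
  let (ρ , α≡ρ) = seedAutomorphism α aut
  in ρ , λ x → trans (sym (strictlyInverseʳ ℓ (to σ x))) (cong (from ℓ)
         (trans (cong (to ℓ ∘ to σ) (sym (strictlyInverseʳ ℓ x))) (α≡ρ (to ℓ x))))
  where
  open ≡-Reasoning
  α = ℓ ↔-∘ (σ ↔-∘ ↔-sym ℓ)
  aut : SeedAutomorphism α
  aut u v = begin
    seedEdge (to α u) (to α v)                               ≡⟨ edge-X ℓ _ _ ⟨
    edge (X ℓ) (to σ (from ℓ u)) (to σ (from ℓ v))           ≡⟨ cong (λ F → edge F (to σ (from ℓ u)) (to σ (from ℓ v))) eq ⟨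
    edge (σ · X ℓ) (to σ (from ℓ u)) (to σ (from ℓ v))       ≡⟨ edge-·-⟨$⟩ʳ σ (X ℓ) _ _ ⟩
    edge (X ℓ) (from ℓ u) (from ℓ v)                         ≡⟨ edge-X ℓ _ _ ⟩
    seedEdge (to ℓ (from ℓ u)) (to ℓ (from ℓ v))             ≡⟨ cong₂ seedEdge (strictlyInverseˡ ℓ u) (strictlyInverseˡ ℓ v) ⟩
    seedEdge u v                                             ∎

-- As a consequence, any two permutations with the same image of the seed have the same sign; this
-- is what an odd relabelling of the selectors contradicts.
stabilizer-X-even : (ℓ : Labelling (suc (suc k))) (σ : Permutation′ (2 * suc (suc k))) →
                    σ · X ℓ ≡ X ℓ → sgn σ ≡ 0ℙ
stabilizer-X-even ℓ σ eq = let (ρ , σ≈ρ) = stabilizer-X ℓ σ eq in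
  trans (sgn-cong {σ = σ} {diagonal ℓ ρ} σ≈ρ) (sgn-diagonal ℓ ρ)

-- Counting the even orbit

-- Permutations have no extensional equality, so they are counted through Lehmer codes.
opaque
  Code : ℕ → Set
  Code zero    = ⊤
  Code (suc n) = Fin (suc n) × Code n

  Code↔ : ∀ n → Code n ↔ Fin (n !)
  Code↔ zero    = ↔-sym Fin.1↔⊤
  Code↔ (suc n) = ↔-sym (Fin.*↔× {suc n}) ↔-∘ (↔-id (Fin (suc n)) ×-↔ Code↔ n)

  decode : Code n → Permutation′ n
  decode {zero}  _       = Perm.id
  decode {suc n} (i , c) = insert 0F i (decode c)

  encode : Permutation′ n → Code n
  encode {zero}  π = tt
  encode {suc n} π = π ⟨$⟩ʳ 0F , encode (remove 0F π)

  decode-encode : (π : Permutation′ n) → decode (encode π) Perm.≈ π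
  decode-encode {suc n} π zero    = refl
  decode-encode {suc n} π (suc i) = trans
    (cong (punchIn (π ⟨$⟩ʳ 0F)) (decode-encode (remove 0F π) i))
    (Perm.insert-remove 0F π (suc i))

  encode-cong : (π ρ : Permutation′ n) → π Perm.≈ ρ → encode π ≡ encode ρ
  encode-cong {zero}  π ρ π≈ρ = refl
  encode-cong {suc n} π ρ π≈ρ = cong₂ _,_ (π≈ρ 0F) (encode-cong (remove 0F π) (remove 0F ρ) λ i →
    Fin.punchIn-injective (π ⟨$⟩ʳ 0F) _ _ (begin
      punchIn (π ⟨$⟩ʳ 0F) (remove 0F π ⟨$⟩ʳ i) ≡⟨ Perm.punchIn-permute π 0F i ⟨
      π ⟨$⟩ʳ suc i                             ≡⟨ π≈ρ (suc i) ⟩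
      ρ ⟨$⟩ʳ suc i                             ≡⟨ Perm.punchIn-permute ρ 0F i ⟩
      punchIn (ρ ⟨$⟩ʳ 0F) (remove 0F ρ ⟨$⟩ʳ i) ≡⟨ cong (λ x → punchIn x (remove 0F ρ ⟨$⟩ʳ i)) (π≈ρ 0F) ⟨
      punchIn (π ⟨$⟩ʳ 0F) (remove 0F ρ ⟨$⟩ʳ i) ∎))
    where open ≡-Reasoning

  encode-decode : (c : Code n) → encode (decode c) ≡ c
  encode-decode {zero}  tt      = refl
  encode-decode {suc n} (i , c) = cong (i ,_) (trans
    (encode-cong (remove 0F (insert 0F i (decode c))) (decode c) (Perm.remove-insert 0F i (decode c)))
    (encode-decode c))

encode-injective : (π ρ : Permutation′ n) → encode π ≡ encode ρ → π Perm.≈ ρ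
encode-injective π ρ eq i = trans (sym (decode-encode π i))
  (trans (cong (λ c → decode c ⟨$⟩ʳ i) eq) (decode-encode ρ i))

decode-injective : {c d : Code n} → decode c Perm.≈ decode d → c ≡ d
decode-injective {c = c} {d} eq =
  trans (sym (encode-decode c)) (trans (encode-cong (decode c) (decode d) eq) (encode-decode d))

bijection : (f : A → B) → (∀ {x y} → f x ≡ f y → x ≡ y) → (∀ y → ∃[ x ] f x ≡ y) → A ↔ B
bijection f inj surj = mk↔ₛ′ f (proj₁ ∘ surj) (proj₂ ∘ surj) (λ x → inj (proj₂ (surj (f x))))

opaque
  -- Membership in the orbit is stored irrelevantly. Since it is decidable, a representative can be
  -- recomputed, and it depends on the graph `F` only.
  chosen : (ℓ : Labelling k) (F : 𝓕 ℓ) → EvenOrbit (X ℓ) (value F)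
  chosen ℓ (F ,ᵣ [ o ]) = recompute (evenOrbit? (X ℓ) F) o

σ⟨_,_⟩ : (ℓ : Labelling k) → 𝓕 ℓ → Permutation′ (2 * k)
σ⟨ ℓ , F ⟩ = proj₁ (chosen ℓ F)

σ-even : (ℓ : Labelling k) (F : 𝓕 ℓ) → sgn σ⟨ ℓ , F ⟩ ≡ 0ℙ
σ-even ℓ F = even⇒sgn {σ = σ⟨ ℓ , F ⟩} (proj₁ (proj₂ (chosen ℓ F)))

σ·X : (ℓ : Labelling k) (F : 𝓕 ℓ) → value F ≡ σ⟨ ℓ , F ⟩ · X ℓ
σ·X ℓ F = proj₂ (proj₂ (chosen ℓ F))

module _ {k : ℕ} (ℓ : Labelling (suc (suc k))) where
  private
    R = 2 * suc (suc k)

    t01 : Permutation′ R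
    t01 = transpose 0F 1F

    -- Representatives of the two cosets of the even permutations.
    twist : Fin 2 → Permutation′ R
    twist 0F = Perm.id
    twist 1F = t01

    twist-involutive : ∀ s x → to (twist s) (to (twist s) x) ≡ x
    twist-involutive 0F x             = refl
    twist-involutive 1F 0F            = refl
    twist-involutive 1F 1F            = refl
    twist-involutive 1F (suc (suc x)) = refl

    twist-parity : Fin 2 → Parity
    twist-parity 0F = 0ℙ
    twist-parity 1F = 1ℙ

    twist-parity-injective : ∀ s s′ → twist-parity s ≡ twist-parity s′ → s ≡ s′
    twist-parity-injective 0F 0F _ = refl
    twist-parity-injective 1F 1F _ = refl
    twist-parity-injective 0F 1F ()
    twist-parity-injective 1F 0F ()

    sgn-twist : ∀ s → sgn (twist s) ≡ twist-parity s
    sgn-twist 0F = sgn-id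
    sgn-twist 1F = sgn-transpose-01

    even-twist : (π : Permutation′ R) → ∃[ s ] sgn (twist s ∘ₚ π) ≡ 0ℙ
    even-twist π = by-sign (sgn π) refl
      where
      by-sign : ∀ p → sgn π ≡ p → ∃[ s ] sgn (twist s ∘ₚ π) ≡ 0ℙ
      by-sign 0ℙ eq = 0F , trans (sgn-∘ Perm.id π) (cong₂ ℙ._+_ (sgn-id {R}) eq)
      by-sign 1ℙ eq = 1F , trans (sgn-∘ t01 π) (cong₂ ℙ._+_ sgn-transpose-01 eq)

    -- Every permutation is assembled in exactly one way from a member of the orbit, a sign and
    -- an automorphism of the seed.
    assemble : 𝓕 ℓ → Fin 2 → Permutation′ (suc (suc k)) → Permutation′ R
    assemble F s ρ = twist s ∘ₚ diagonal ℓ ρ ∘ₚ σ⟨ ℓ , F ⟩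

    sgn-assemble : ∀ F s ρ → sgn (assemble F s ρ) ≡ twist-parity s
    sgn-assemble F s ρ = begin
      sgn (twist s ∘ₚ diagonal ℓ ρ ∘ₚ σ⟨ ℓ , F ⟩)                   ≡⟨ sgn-∘ (twist s) (diagonal ℓ ρ ∘ₚ σ⟨ ℓ , F ⟩) ⟩
      sgn (twist s) ℙ.+ sgn (diagonal ℓ ρ ∘ₚ σ⟨ ℓ , F ⟩)            ≡⟨ cong (sgn (twist s) ℙ.+_) (sgn-∘ (diagonal ℓ ρ) σ⟨ ℓ , F ⟩) ⟩
      sgn (twist s) ℙ.+ (sgn (diagonal ℓ ρ) ℙ.+ sgn σ⟨ ℓ , F ⟩)     ≡⟨ cong (sgn (twist s) ℙ.+_) (cong₂ ℙ._+_ (sgn-diagonal ℓ ρ) (σ-even ℓ F)) ⟩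
      sgn (twist s) ℙ.+ 0ℙ                                      ≡⟨ ℙ.+-identityʳ _ ⟩
      sgn (twist s)                                             ≡⟨ sgn-twist s ⟩
      twist-parity s                                            ∎
      where open ≡-Reasoning

    assemble-X : ∀ F ρ → (diagonal ℓ ρ ∘ₚ σ⟨ ℓ , F ⟩) · X ℓ ≡ value F
    assemble-X F ρ = trans (·-∘ (diagonal ℓ ρ) σ⟨ ℓ , F ⟩ (X ℓ))
      (trans (cong (σ⟨ ℓ , F ⟩ ·_) (diagonal-X ℓ ρ)) (sym (σ·X ℓ F)))

    code : 𝓕 ℓ × (Fin 2 × Code (suc (suc k))) → Code R
    code (F , s , c) = encode (assemble F s (decode c))

    -- The sign of the assembled permutation gives back `s`. Once the twist is cancelled, the image
    -- of the seed gives back `F`, and cancelling `σ⟨ ℓ , F ⟩` leaves the diagonal permutation.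
    code-injective : ∀ {x y} → code x ≡ code y → x ≡ y
    code-injective {F , s , c} {F′ , s′ , c′} eq = helper s≡s′ F≡F′
      where
      ≈₁ : assemble F s (decode c) Perm.≈ assemble F′ s′ (decode c′)
      ≈₁ = encode-injective (assemble F s (decode c)) (assemble F′ s′ (decode c′)) eq

      s≡s′ : s ≡ s′
      s≡s′ = twist-parity-injective s s′ (trans (sym (sgn-assemble F s (decode c)))
        (trans (sgn-cong {σ = assemble F s (decode c)} {assemble F′ s′ (decode c′)} ≈₁)
               (sgn-assemble F′ s′ (decode c′))))

      ≈₂ : diagonal ℓ (decode c) ∘ₚ σ⟨ ℓ , F ⟩ Perm.≈ diagonal ℓ (decode c′) ∘ₚ σ⟨ ℓ , F′ ⟩
      ≈₂ x = begin
        to δ x                              ≡⟨ cong (to δ) (twist-involutive s x) ⟨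
        to δ (to (twist s) (to (twist s) x))   ≡⟨ ≈₁ (to (twist s) x) ⟩
        to δ′ (to (twist s′) (to (twist s) x)) ≡⟨ cong (λ z → to δ′ (to (twist z) (to (twist s) x))) s≡s′ ⟨
        to δ′ (to (twist s) (to (twist s) x))  ≡⟨ cong (to δ′) (twist-involutive s x) ⟩
        to δ′ x                             ∎
        where
        open ≡-Reasoning
        δ  = diagonal ℓ (decode c) ∘ₚ σ⟨ ℓ , F ⟩
        δ′ = diagonal ℓ (decode c′) ∘ₚ σ⟨ ℓ , F′ ⟩

      F≡F′ : F ≡ F′
      F≡F′ = Refinement.value-injective (trans (sym (assemble-X F (decode c)))
        (trans (·-cong {σ = diagonal ℓ (decode c) ∘ₚ σ⟨ ℓ , F ⟩} {diagonal ℓ (decode c′) ∘ₚ σ⟨ ℓ , F′ ⟩} (X ℓ) ≈₂)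
               (assemble-X F′ (decode c′))))

      helper : s ≡ s′ → F ≡ F′ → (F , s , c) ≡ (F′ , s′ , c′)
      helper refl refl = cong (λ z → F , s , z) (decode-injective
        (diagonal-injective ℓ (decode c) (decode c′) λ x → to-injective σ⟨ ℓ , F ⟩ (≈₂ x)))

    -- A twist makes `π` even, and `F` is the image of the seed under the result. Undoing the
    -- representative of `F` leaves a permutation that fixes the seed, hence a diagonal one.
    code-surjective : ∀ d → ∃[ x ] code x ≡ d
    code-surjective d = (F , s , encode ρ) , trans
      (encode-cong (assemble F s (decode (encode ρ))) π recover) (encode-decode d)
      where
      π = decode d
      s = proj₁ (even-twist π)
      π′ = twist s ∘ₚ π
      F : 𝓕 ℓ
      F = π′ · X ℓ ,ᵣ [ π′ , sgn⇒even {σ = π′} (proj₂ (even-twist π)) , refl ]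
      α = π′ ∘ₚ flip σ⟨ ℓ , F ⟩

      α-X : α · X ℓ ≡ X ℓ
      α-X = trans (·-∘ π′ (flip σ⟨ ℓ , F ⟩) (X ℓ))
        (trans (cong (flip σ⟨ ℓ , F ⟩ ·_) (σ·X ℓ F)) (·-flip σ⟨ ℓ , F ⟩ (X ℓ)))

      ρ = proj₁ (stabilizer-X ℓ α α-X)
      α≈ρ : α Perm.≈ diagonal ℓ ρ
      α≈ρ = proj₂ (stabilizer-X ℓ α α-X)

      recover : assemble F s (decode (encode ρ)) Perm.≈ π
      recover x = begin
        to σ⟨ ℓ , F ⟩ (to (diagonal ℓ (decode (encode ρ))) y) ≡⟨ cong (to σ⟨ ℓ , F ⟩) (diagonal-cong ℓ (decode (encode ρ)) ρ (decode-encode ρ) y) ⟩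
        to σ⟨ ℓ , F ⟩ (to (diagonal ℓ ρ) y)                   ≡⟨ cong (to σ⟨ ℓ , F ⟩) (α≈ρ y) ⟨
        to σ⟨ ℓ , F ⟩ (from σ⟨ ℓ , F ⟩ (to π (to (twist s) y)))   ≡⟨ strictlyInverseˡ σ⟨ ℓ , F ⟩ _ ⟩
        to π (to (twist s) y)                             ≡⟨ cong (to π) (twist-involutive s x) ⟩
        to π x                                            ∎
        where
        open ≡-Reasoning
        y = to (twist s) x

  -- Orbit-stabiliser in the form of a product: the factor 2 counts the sign, the factorial the
  -- automorphisms of the seed.
  size-𝓕-* : Finite.size (finite-EvenOrbit (X ℓ)) * (2 * suc (suc k) !) ≡ R !
  size-𝓕-* = Perm.↔⇒≡ (Code↔ R ↔-∘ (bijection code code-injective code-surjective ↔-∘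
    ((↔-sym (Finite.index (finite-EvenOrbit (X ℓ))) ×-↔ ((↔-id (Fin 2) ×-↔ ↔-sym (Code↔ (suc (suc k)))) ↔-∘ Fin.*↔× {2}))
      ↔-∘ Fin.*↔× {Finite.size (finite-EvenOrbit (X ℓ))})))

  size-𝓕 : Finite.size (finite-EvenOrbit (X ℓ)) ≡
           ℕ._/_ (R !) (2 * suc (suc k) !) {{ℕ.m*n≢0 2 (suc (suc k) !) {{_}} {{suc (suc k) ℕ.!≢0}}}}
  size-𝓕 = trans (sym (m*n/n≡m (Finite.size (finite-EvenOrbit (X ℓ))) (2 * suc (suc k) !)))
                 (cong (ℕ._/ (2 * suc (suc k) !)) size-𝓕-*)
    where instance
      _ : ℕ.NonZero (2 * suc (suc k) !)
      _ = ℕ.m*n≢0 2 (suc (suc k) !) {{_}} {{suc (suc k) ℕ.!≢0}}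

-- Blow-ups of the selector

Ports : (Fin r → ℕ) → Set
Ports {r} a = Σ[ i ∈ Fin r ] Fin (a i)

ports-≡ : {a : Fin r → ℕ} {p q : Ports a} → proj₁ p ≡ proj₁ q → toℕ (proj₂ p) ≡ toℕ (proj₂ q) → p ≡ q
ports-≡ {p = i , _} {.i , _} refl eq = cong (i ,_) (Fin.toℕ-injective eq)

relabel : (τ : Permutation′ r) {a b : Fin r → ℕ} → (∀ i → b (τ ⟨$⟩ʳ i) ≡ a i) → Ports a ↔ Ports b
relabel τ {a} {b} eq = mk↔ₛ′
  (λ (i , c) → τ ⟨$⟩ʳ i , cast (sym (eq i)) c)
  (λ (j , c) → τ ⟨$⟩ˡ j , cast (eq⁻¹ j) c)
  (λ (j , c) → ports-≡ (Perm.inverseʳ τ)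
    (trans (Fin.toℕ-cast (sym (eq (τ ⟨$⟩ˡ j))) (cast (eq⁻¹ j) c)) (Fin.toℕ-cast (eq⁻¹ j) c)))
  (λ (i , c) → ports-≡ (Perm.inverseˡ τ)
    (trans (Fin.toℕ-cast (eq⁻¹ (τ ⟨$⟩ʳ i)) (cast (sym (eq i)) c)) (Fin.toℕ-cast (sym (eq i)) c)))
  where
  eq⁻¹ : ∀ j → b j ≡ a (τ ⟨$⟩ˡ j)
  eq⁻¹ j = trans (cong b (sym (Perm.inverseʳ τ))) (eq (τ ⟨$⟩ˡ j))

-- The involution that fixes c and exchanges the rest of the class of i with the class of j.
module Exchange {a : Fin r → ℕ} {i j : Fin r} (i≢j : i ≢ j) (size-eq : a i ≡ suc (a j)) (c : Fin (a i)) where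
  private
    c′ : Fin (suc (a j))
    c′ = cast size-eq c

    -- Skipping `c` enumerates the rest of the class of `i`, which by `size-eq` has exactly `a j`
    -- members.
    up : Fin (a j) → Fin (a i)
    up x = cast (sym size-eq) (punchIn c′ x)

    cast-injective : ∀ {m n} .(eq : m ≡ n) {x y : Fin m} → cast eq x ≡ cast eq y → x ≡ y
    cast-injective eq {x} {y} e = Fin.toℕ-injective
      (trans (sym (Fin.toℕ-cast eq x)) (trans (cong toℕ e) (Fin.toℕ-cast eq y)))

    down : (y : Fin (a i)) → y ≢ c → Fin (a j)
    down y y≢c = punchOut {i = c′} {cast size-eq y} (y≢c ∘ sym ∘ cast-injective size-eq)

    cast-up : ∀ x → cast size-eq (up x) ≡ punchIn c′ x
    cast-up x = Fin.toℕ-injective (trans (Fin.toℕ-cast size-eq (up x)) (Fin.toℕ-cast (sym size-eq) (punchIn c′ x)))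

    up≢c : ∀ x → up x ≢ c
    up≢c x eq = Fin.punchInᵢ≢i c′ x (trans (sym (cast-up x)) (cong (cast size-eq) eq))

    up-down : ∀ y y≢c → up (down y y≢c) ≡ y
    up-down y y≢c = Fin.toℕ-injective (trans (Fin.toℕ-cast _ _)
      (trans (cong toℕ (Fin.punchIn-punchOut {i = c′} {cast size-eq y} _)) (Fin.toℕ-cast _ y)))

    down-up : ∀ x up≢c → down (up x) up≢c ≡ x
    down-up x up≢c = Fin.punchIn-injective c′ _ _ (trans (Fin.punchIn-punchOut _) (cast-up x))

  exchange : Ports a → Ports a
  exchange (l , x) with l Fin.≟ i
  ... | yes refl with x Fin.≟ c
  ...   | yes _  = i , x
  ...   | no x≢c = j , down x x≢c
  exchange (l , x) | no _ with l Fin.≟ j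
  ...   | yes refl = i , up x
  ...   | no _     = l , x

  exchange-c : exchange (i , c) ≡ (i , c)
  exchange-c with i Fin.≟ i
  ... | no i≢i = contradiction refl i≢i
  ... | yes refl with c Fin.≟ c
  ...   | yes _   = refl
  ...   | no c≢c = contradiction refl c≢c

  private
    -- `exchange` uses the disequality produced by its own decision, so that proof is returned along
    -- with the equation.
    exchange-i : ∀ x → x ≢ c → ∃[ x≢c ] exchange (i , x) ≡ (j , down x x≢c)
    exchange-i x x≢c with i Fin.≟ i
    ... | no i≢i = contradiction refl i≢i
    ... | yes refl with x Fin.≟ c
    ...   | yes x≡c = contradiction x≡c x≢c
    ...   | no x≢c′ = x≢c′ , refl

    exchange-j : ∀ x → exchange (j , x) ≡ (i , up x)
    exchange-j x with j Fin.≟ i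
    ... | yes j≡i = contradiction (sym j≡i) i≢j
    ... | no _ with j Fin.≟ j
    ...   | yes refl = refl
    ...   | no j≢j   = contradiction refl j≢j

    exchange-l : ∀ l x → l ≢ i → l ≢ j → exchange (l , x) ≡ (l , x)
    exchange-l l x l≢i l≢j with l Fin.≟ i
    ... | yes l≡i = contradiction l≡i l≢i
    ... | no _ with l Fin.≟ j
    ...   | yes l≡j = contradiction l≡j l≢j
    ...   | no _    = refl

  exchange-involutive : ∀ p → exchange (exchange p) ≡ p
  exchange-involutive (l , x) = by-class (l Fin.≟ i) (l Fin.≟ j)
    where
    by-element : ∀ x → Dec (x ≡ c) → exchange (exchange (i , x)) ≡ (i , x)
    by-element x (yes refl) = trans (cong exchange exchange-c) exchange-c
    by-element x (no x≢c)   = let (x≢c′ , eq) = exchange-i x x≢c in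
      trans (cong exchange eq) (trans (exchange-j (down x x≢c′)) (cong (i ,_) (up-down x x≢c′)))

    by-class : Dec (l ≡ i) → Dec (l ≡ j) → exchange (exchange (l , x)) ≡ (l , x)
    by-class (yes refl) _          = by-element x (x Fin.≟ c)
    by-class (no _)     (yes refl) = let (up≢c′ , eq) = exchange-i (up x) (up≢c x) in
      trans (cong exchange (exchange-j x)) (trans eq (cong (j ,_) (down-up x up≢c′)))
    by-class (no l≢i)   (no l≢j)   = trans (cong exchange (exchange-l l x l≢i l≢j)) (exchange-l l x l≢i l≢j)

  exchange↔ : Ports a ↔ Ports a
  exchange↔ = mk↔ₛ′ exchange exchange exchange-involutive exchange-involutive

  exchange-class : ∀ p → p ≢ (i , c) → proj₁ (exchange p) ≡ transpose i j ⟨$⟩ʳ proj₁ p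
  exchange-class (l , x) p≢ = by-class (l Fin.≟ i) (l Fin.≟ j)
    where
    by-class : Dec (l ≡ i) → Dec (l ≡ j) → proj₁ (exchange (l , x)) ≡ transpose i j ⟨$⟩ʳ l
    by-class (yes refl) _          =
      trans (cong proj₁ (proj₂ (exchange-i x (λ x≡c → p≢ (cong (l ,_) x≡c))))) (sym (transpose-first i j))
    by-class (no _)     (yes refl) = trans (cong proj₁ (exchange-j x)) (sym (transpose-second i j))
    by-class (no l≢i)   (no l≢j)   = trans (cong proj₁ (exchange-l l x l≢i l≢j)) (sym (transpose-other l≢i l≢j))

⌊⌋-not⇒≡ : (_≟_ : DecidableEquality A) (x y : A) → not ⌊ x ≟ y ⌋ ≡ false → x ≡ y
⌊⌋-not⇒≡ _≟_ x y eq with x ≟ y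
... | yes x≡y = x≡y

module _ {k : ℕ} (ℓ : Labelling (suc (suc k))) where
  private
    R : ℕ
    R = 2 * suc (suc k)

  4≤R : 4 ≤ R
  4≤R = ℕ.*-monoʳ-≤ 2 (s≤s (s≤s z≤n))

  3≤R : 3 ≤ R
  3≤R = ℕ.≤-trans (ℕ.n≤1+n 3) 4≤R

  module _ {a b : Fin R → ℕ} (f : Ports a ↔ Ports b) where

    vertex↔ : Permutation′ R → 𝓕 ℓ ↔ 𝓕 ℓ → V (S⟨ ℓ ⟩ a) ↔ V (S⟨ ℓ ⟩ b)
    vertex↔ σ g = f ⊎-↔ (pair↔ σ ⊎-↔ g)

    -- Compatibility of `f` with `σ` is demanded only of ports that occur as `x` or `y`. This leaves
    -- room for one exceptional port, the one that a card removes.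
    vertex↔-adj : (σ : Permutation′ R) (even-σ : sgn σ ≡ 0ℙ) (x y : V (S⟨ ℓ ⟩ a)) →
      (∀ p → x ≡ port p → proj₁ (to f p) ≡ σ ⟨$⟩ʳ proj₁ p) →
      (∀ p → y ≡ port p → proj₁ (to f p) ≡ σ ⟨$⟩ʳ proj₁ p) →
      Graph.adj (S⟨ ℓ ⟩ b) (to (vertex↔ σ (𝓕↔ ℓ σ even-σ)) x) (to (vertex↔ σ (𝓕↔ ℓ σ even-σ)) y)
        ≡ Graph.adj (S⟨ ℓ ⟩ a) x y
    vertex↔-adj σ even-σ (port p) (port q) _ _ = refl
    vertex↔-adj σ even-σ (port p) (pair q) fp _ =
      trans (cong (contains (σ ·ₚ q)) (fp p refl)) (contains-·ₚ σ q (proj₁ p))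
    vertex↔-adj σ even-σ (port p) (sel F)  _ _ = refl
    vertex↔-adj σ even-σ (pair q) (port p) _ fp =
      trans (cong (contains (σ ·ₚ q)) (fp p refl)) (contains-·ₚ σ q (proj₁ p))
    vertex↔-adj σ even-σ (pair q) (pair _) _ _ = refl
    vertex↔-adj σ even-σ (pair q) (sel F)  _ _ = edgeAt-· σ (value F) q
    vertex↔-adj σ even-σ (sel F)  (port p) _ _ = refl
    vertex↔-adj σ even-σ (sel F)  (pair q) _ _ = edgeAt-· σ (value F) q
    vertex↔-adj σ even-σ (sel F)  (sel F′) _ _ = cong not
      (⌊⌋-injective (Refinement._≟_ _≟ᴸ_) (Refinement._≟_ _≟ᴸ_) (to (𝓕↔ ℓ σ even-σ))
        (to-injective (𝓕↔ ℓ σ even-σ)) F F′)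

  -- Removing a port of class i leaves classes i and j of the same size, so an odd relabelling
  -- becomes even after composition with the transposition of i and j.
  card-≅ : {a b : Fin R → ℕ} (τ : Permutation′ R) (eq : ∀ i → b (τ ⟨$⟩ʳ i) ≡ a i) → sgn τ ≡ 1ℙ →
           {i j : Fin R} → i ≢ j → a i ≡ suc (a j) → (c : Fin (a i)) →
           (S⟨ ℓ ⟩ a ─ port (i , c)) ≅ (S⟨ ℓ ⟩ b ─ port (to (relabel τ eq) (i , c)))
  card-≅ {a} {b} τ eq odd-τ {i} {j} i≢j size-eq c =
    -- The exchange fixes the removed port, so its partner is given by `relabel` alone; distinct
    -- removed ports then have distinct partners.
    subst (λ p → (S⟨ ℓ ⟩ a ─ port (i , c)) ≅ (S⟨ ℓ ⟩ b ─ port p)) (cong (to (relabel τ eq)) exchange-c)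
      (─-≅ {S⟨ ℓ ⟩ a} {S⟨ ℓ ⟩ b} (vertex↔ f σ (𝓕↔ ℓ σ even-σ)) (port (i , c)) λ x y x≢ y≢ →
        vertex↔-adj f σ even-σ x y (class x x≢) (class y y≢))
    where
    open Exchange {a = a} i≢j size-eq c
    f = relabel τ eq ↔-∘ exchange↔
    σ = transpose i j ∘ₚ τ
    even-σ : sgn σ ≡ 0ℙ
    even-σ = trans (sgn-∘ (transpose i j) τ) (cong₂ ℙ._+_ (sgn-transpose i≢j) odd-τ)
    class : ∀ x → x ≢ port (i , c) → ∀ p → x ≡ port p → proj₁ (to f p) ≡ σ ⟨$⟩ʳ proj₁ p
    class x x≢ p refl = cong (τ ⟨$⟩ʳ_) (exchange-class p (x≢ ∘ cong port))

  -- Degree sequences of blow-ups with permuted class sizes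

  module _ {a b : Fin R → ℕ} (τ : Permutation′ R) (eq : ∀ i → b (τ ⟨$⟩ʳ i) ≡ a i) where

    -- The selectors stay in place because `τ` may be odd and need not map the even orbit to itself;
    -- only degrees are claimed to be preserved.
    blowUp↔ : V (S⟨ ℓ ⟩ a) ↔ V (S⟨ ℓ ⟩ b)
    blowUp↔ = vertex↔ (relabel τ eq) τ (↔-id (𝓕 ℓ))

    -- A port sees only pairs, which `τ` carries along. For a pair, an even `ρ` agreeing with `τ` on
    -- its two labels matches the selectors that choose it with those that choose its image. A
    -- selector keeps its neighbours when pairs and selectors are both left fixed.
    degree-blowUp : ∀ u → Graph.degree (S⟨ ℓ ⟩ a) u ≡ Graph.degree (S⟨ ℓ ⟩ b) (to blowUp↔ u)
    degree-blowUp (port p) = degree-cong {S⟨ ℓ ⟩ a} {S⟨ ℓ ⟩ b} blowUp↔ (port p) (to blowUp↔ (port p)) λ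
      { (port _) → refl
      ; (pair q) → sym (contains-·ₚ τ q (proj₁ p))
      ; (sel _)  → refl }
    degree-blowUp (pair q) = degree-cong {S⟨ ℓ ⟩ a} {S⟨ ℓ ⟩ b} (vertex↔ (relabel τ eq) τ (𝓕↔ ℓ ρ even-ρ))
      (pair q) (pair (τ ·ₚ q)) λ
      { (port p) → sym (contains-·ₚ τ q (proj₁ p))
      ; (pair _) → refl
      ; (sel F)  → sym (trans (cong (edgeAt (ρ · value F)) τq≡ρq) (edgeAt-· ρ (value F) q)) }
      where
      i = proj₁ (value q)
      j = proj₂ (value q)
      agree = even-2-transitive 4≤R (proj₁≢proj₂ q) (proj₁≢proj₂ q ∘ to-injective τ)
      ρ = proj₁ agree
      even-ρ = proj₁ (proj₂ agree)

      ⁅⁆-cong : {i i′ j j′ : Fin R} .(i≢j : i ≢ j) .(i′≢j′ : i′ ≢ j′) → i ≡ i′ → j ≡ j′ → ⁅ i , j ⁆ i≢j ≡ ⁅ i′ , j′ ⁆ i′≢j′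
      ⁅⁆-cong _ _ refl refl = refl

      τq≡ρq : τ ·ₚ q ≡ ρ ·ₚ q
      τq≡ρq = sym (⁅⁆-cong (proj₁≢proj₂ q ∘ to-injective ρ) (proj₁≢proj₂ q ∘ to-injective τ)
        (proj₁ (proj₂ (proj₂ agree))) (proj₂ (proj₂ (proj₂ agree))))
    degree-blowUp (sel F) = degree-cong {S⟨ ℓ ⟩ a} {S⟨ ℓ ⟩ b} (relabel τ eq ⊎-↔ (↔-id (Pair R) ⊎-↔ ↔-id (𝓕 ℓ)))
      (sel F) (sel F) λ
      { (port _) → refl
      ; (pair _) → refl
      ; (sel _)  → refl }

    sameDegreeSequence-blowUp : SameDegreeSequence (S⟨ ℓ ⟩ a) (S⟨ ℓ ⟩ b)
    sameDegreeSequence-blowUp = sameDegreeSequence {S⟨ ℓ ⟩ a} {S⟨ ℓ ⟩ b} blowUp↔ degree-blowUp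

    order-blowUp : Graph.order (S⟨ ℓ ⟩ a) ≡ Graph.order (S⟨ ℓ ⟩ b)
    order-blowUp = size-↔ (Graph.finite (S⟨ ℓ ⟩ a)) (Graph.finite (S⟨ ℓ ⟩ b)) blowUp↔

  -- The perfect matching between A and D, carried over to F; it shows that F is not a star.
  matching : (F : 𝓕 ℓ) → Fin (suc (suc k)) ⊎ Fin (suc (suc k)) → Fin R
  matching F u = σ⟨ ℓ , F ⟩ ⟨$⟩ʳ from ℓ u

  matching-injective : (F : 𝓕 ℓ) {u v : Fin (suc (suc k)) ⊎ Fin (suc (suc k))} →
                       matching F u ≡ matching F v → u ≡ v
  matching-injective F = to-injective (↔-sym ℓ) ∘ to-injective σ⟨ ℓ , F ⟩

  matching-≢ : (F : 𝓕 ℓ) (i : Fin (suc (suc k))) → matching F (inj₁ i) ≢ matching F (inj₂ i)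
  matching-≢ F i eq with () ← matching-injective F eq

  matchingPair : 𝓕 ℓ → Fin (suc (suc k)) → Pair R
  matchingPair F i = ⁅ matching F (inj₁ i) , matching F (inj₂ i) ⁆ (matching-≢ F i)

  edgeAt-matchingPair : (F : 𝓕 ℓ) (i : Fin (suc (suc k))) → edgeAt (value F) (matchingPair F i) ≡ true
  edgeAt-matchingPair F i = begin
    edgeAt (value F) (matchingPair F i)                                 ≡⟨ edgeAt-⁅⁆ (value F) _ _ (matching-≢ F i) ⟩
    edge (value F) (matching F (inj₁ i)) (matching F (inj₂ i))          ≡⟨ cong (λ H → edge H (matching F (inj₁ i)) (matching F (inj₂ i))) (σ·X ℓ F) ⟩
    edge (σ⟨ ℓ , F ⟩ · X ℓ) (matching F (inj₁ i)) (matching F (inj₂ i)) ≡⟨ edge-·-⟨$⟩ʳ σ⟨ ℓ , F ⟩ (X ℓ) _ _ ⟩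
    edge (X ℓ) (from ℓ (inj₁ i)) (from ℓ (inj₂ i))                      ≡⟨ edge-X ℓ _ _ ⟩
    seedEdge (to ℓ (from ℓ (inj₁ i))) (to ℓ (from ℓ (inj₂ i)))          ≡⟨ cong₂ seedEdge (strictlyInverseˡ ℓ (inj₁ i)) (strictlyInverseˡ ℓ (inj₂ i)) ⟩
    seedEdge {suc (suc k)} (inj₁ i) (inj₂ i)                            ≡⟨ ≡⇒⌊≟⌋ i ⟩
    true                                                                ∎
    where open ≡-Reasoning

  -- In a star every edge contains the centre, but two edges of the matching are disjoint. This
  -- prevents a port from being a twin of a selector.
  ¬star : (F : 𝓕 ℓ) (l : Fin R) → ¬ (∀ q → contains q l ≡ edgeAt (value F) q)
  ¬star F l star = disjoint (covers 0F) (covers 1F)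
    where
    covers : ∀ i → l ≡ matching F (inj₁ i) ⊎ l ≡ matching F (inj₂ i)
    covers i = ∈-⁅⁆⁻¹ _ _ (matching-≢ F i) (trans (star (matchingPair F i)) (edgeAt-matchingPair F i))

    disjoint : l ≡ matching F (inj₁ 0F) ⊎ l ≡ matching F (inj₂ 0F) →
               l ≡ matching F (inj₁ 1F) ⊎ l ≡ matching F (inj₂ 1F) → ⊥
    disjoint (inj₁ p) (inj₁ q) with () ← matching-injective F (trans (sym p) q)
    disjoint (inj₁ p) (inj₂ q) with () ← matching-injective F (trans (sym p) q)
    disjoint (inj₂ p) (inj₁ q) with () ← matching-injective F (trans (sym p) q)
    disjoint (inj₂ p) (inj₂ q) with () ← matching-injective F (trans (sym p) q)

  -- Connectedness

  module _ {a : Fin R → ℕ} (1≤a : ∀ i → 1 ≤ a i) where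
    private
      G = S⟨ ℓ ⟩ a

    aPort : ∀ i → Fin (a i)
    aPort i = Fin.fromℕ< (1≤a i)

    -- Ports of different classes share the pair of their labels; ports of one class share a pair
    -- with a third label. Every pair touches a port, and every selector reaches a pair because its
    -- graph has an edge.
    connected-blowUp : Connected G
    connected-blowUp = port (0F , aPort 0F) , λ u v →
      let (p , up) = to-port u; (q , vq) = to-port v in up ◅◅ port-port p q ◅◅ reverse (λ {x} {y} → edge-reverse x y) vq
      where
      Edge : V G → V G → Set
      Edge x y = adj G x y ≡ true

      edge-reverse : ∀ x y → Edge x y → Edge y x
      edge-reverse x y e = trans (adj-sym G y x) e

      port-port : ∀ p q → Star Edge (port p) (port q)
      port-port p@(i , _) q@(j , _) = by-class (i Fin.≟ j) (third 3≤R i j)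
        where
        via : ∀ l (i≢l : i ≢ l) → j ≡ i ⊎ j ≡ l → Star Edge (port p) (port q)
        via l i≢l j∈ = _◅_ {j = pair (⁅ i , l ⁆ i≢l)} (∈-⁅⁆ i l i≢l (inj₁ refl)) (∈-⁅⁆ i l i≢l j∈ ◅ ε)

        by-class : Dec (i ≡ j) → ∃[ l ] (l ≢ i × l ≢ j) → Star Edge (port p) (port q)
        by-class (no i≢j)  _             = via j i≢j (inj₂ refl)
        by-class (yes i≡j) (l , l≢i , _) = via l (l≢i ∘ sym) (inj₁ (sym i≡j))

      pair-to-port : ∀ q → ∃[ p ] Star Edge (pair q) (port p)
      pair-to-port q = (proj₁ (value q) , aPort _) , contains-fst q ◅ ε

      to-port : ∀ u → ∃[ p ] Star Edge u (port p)
      to-port (port p) = p , ε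
      to-port (pair q) = pair-to-port q
      to-port (sel F)  = let (p , path) = pair-to-port (matchingPair F 0F) in
        p , edgeAt-matchingPair F 0F ◅ path

-- Twins, and what an isomorphism of blow-ups preserves

≅-sym : {G H : Graph} → G ≅ H → H ≅ G
≅-sym {G} {H} (f , f-adj) = ↔-sym f , λ u v → trans (sym (f-adj (from f u) (from f v)))
  (cong₂ (adj H) (strictlyInverseˡ f u) (strictlyInverseˡ f v))

≅-adj-from : {G H : Graph} ((f , _) : G ≅ H) → ∀ u w → adj H (to f u) w ≡ adj G u (from f w)
≅-adj-from {G} {H} (f , f-adj) u w =
  trans (cong (adj H (to f u)) (sym (strictlyInverseˡ f w))) (f-adj u (from f w))

HasTwin : (G : Graph) → V G → Set
HasTwin G u = ∃[ v ] (u ≢ v × (∀ w → adj G v w ≡ adj G u w))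

HasTwin-≅ : {G H : Graph} ((f , _) : G ≅ H) → ∀ {u} → HasTwin G u → HasTwin H (to f u)
HasTwin-≅ {G} {H} φ@(f , _) {u} (v , u≢v , twins) = to f v , u≢v ∘ to-injective f , λ w →
  trans (≅-adj-from {G} {H} φ v w) (trans (twins (from f w)) (sym (≅-adj-from {G} {H} φ u w)))

-- The pair formed by `i` and a label different from both contains `j` only if `j` is `i`.
contains-separates : 3 ≤ r → (i j : Fin r) → (∀ q → contains q i ≡ contains q j) → i ≡ j
contains-separates 3≤r i j eq = let (l , l≢i , l≢j) = third 3≤r i j; i≢l = l≢i ∘ sym in
  Sum.[ sym , (λ j≡l → contradiction (sym j≡l) l≢j) ]
    (∈-⁅⁆⁻¹ i l i≢l (trans (sym (eq (⁅ i , l ⁆ i≢l))) (∈-⁅⁆ i l i≢l (inj₁ refl))))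

another-Fin : 2 ≤ n → (c : Fin n) → ∃[ d ] c ≢ d
another-Fin (s≤s (s≤s z≤n)) = another

module _ {k : ℕ} (ℓ : Labelling (suc (suc k))) where
  private
    R : ℕ
    R = 2 * suc (suc k)

  module _ {a : Fin R → ℕ} where
    private
      G = S⟨ ℓ ⟩ a

    port-hasTwin : (∀ i → 2 ≤ a i) → ∀ p → HasTwin G (port p)
    port-hasTwin 2≤a (i , c) = let (d , c≢d) = another-Fin (2≤a i) c in
      port (i , d) , (λ eq → c≢d (Fin.toℕ-injective (cong (toℕ ∘ proj₂) (inj₁-injective eq)))) ,
      λ { (port _) → refl ; (pair _) → refl ; (sel _) → refl }

    module _ (1≤a : ∀ i → 1 ≤ a i) where
      private
        rep : (i : Fin R) → Ports a
        rep i = i , aPort ℓ 1≤a i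

      -- Adjacency to ports decides: ports and selectors have no neighbours among the ports, and
      -- another pair would have to contain the same two labels.
      pair-¬hasTwin : ∀ q → ¬ HasTwin G (pair q)
      pair-¬hasTwin q (port p , _ , twins) with () ← trans (twins (port (rep (proj₁ (value q))))) (contains-fst q)
      pair-¬hasTwin q (sel F  , _ , twins) with () ← trans (twins (port (rep (proj₁ (value q))))) (contains-fst q)
      pair-¬hasTwin q (pair q′ , q≢q′ , twins) = q≢q′ (cong pair
        (pair-unique (proj₁ (value q)) (proj₂ (value q)) (proj₁≢proj₂ q) (contains-fst q) (contains-snd q)
          (trans (twins (port (rep (proj₁ (value q))))) (contains-fst q))
          (trans (twins (port (rep (proj₂ (value q))))) (contains-snd q))))

      -- A port as twin would make `F` a star, a pair has neighbours among the ports, and another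
      -- selector is adjacent to `F` by the clique, while `F` is not adjacent to itself.
      sel-¬hasTwin : ∀ F → ¬ HasTwin G (sel F)
      sel-¬hasTwin F (port p , _ , twins) = ¬star ℓ F (proj₁ p) (twins ∘ pair)
      sel-¬hasTwin F (pair q , _ , twins)
        with () ← trans (sym (contains-fst q)) (twins (port (rep (proj₁ (value q)))))
      sel-¬hasTwin F (sel F′ , F≢F′ , twins) = F≢F′ (cong sel (sym
        (⌊⌋-not⇒≡ (Refinement._≟_ _≟ᴸ_) F′ F (trans (twins (sel F)) (adj-irrefl G (sel F))))))

      hasTwin⇒port : ∀ u → HasTwin G u → ∃[ p ] u ≡ port p
      hasTwin⇒port (port p) _ = p , refl
      hasTwin⇒port (pair q) t = ⊥-elim (pair-¬hasTwin q t)
      hasTwin⇒port (sel F)  t = ⊥-elim (sel-¬hasTwin F t)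

  -- The map of classes is a bare function here. That it is bijective and preserves sizes follows
  -- later from the same data for the inverse isomorphism.
  record PortMap {a b : Fin R → ℕ} (φ : S⟨ ℓ ⟩ a ≅ S⟨ ℓ ⟩ b) : Set where
    field
      onPorts   : Ports a → Ports b
      onClasses : Fin R → Fin R
      onPorts-≡ : ∀ p → to (proj₁ φ) (port p) ≡ port (onPorts p)
      class-≡   : ∀ p → proj₁ (onPorts p) ≡ onClasses (proj₁ p)

    -- A class is mapped injectively into the class of its image. The inverse isomorphism supplies
    -- the opposite inequality.
    size-≤ : ∀ i → a i ≤ b (onClasses i)
    size-≤ i = Fin.injective⇒≤ {f = λ c → cast (cong b (class-≡ (i , c))) (proj₂ (onPorts (i , c)))} λ {c} {d} eq →
      Fin.toℕ-injective (cong (toℕ ∘ proj₂) (inj₁-injective (to-injective (proj₁ φ)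
        (trans (onPorts-≡ (i , c)) (trans (cong port (ports-≡
          (trans (class-≡ (i , c)) (sym (class-≡ (i , d))))
          (trans (sym (Fin.toℕ-cast (cong b (class-≡ (i , c))) (proj₂ (onPorts (i , c)))))
            (trans (cong toℕ eq) (Fin.toℕ-cast (cong b (class-≡ (i , d))) (proj₂ (onPorts (i , d))))))))
          (sym (onPorts-≡ (i , d))))))))

  -- Having a twin is invariant, so ports go to ports. Ports of one class have equal neighbourhoods,
  -- hence their images lie in the same pairs and so in one class.
  portMap : {a b : Fin R → ℕ} → (∀ i → 2 ≤ a i) → (∀ i → 2 ≤ b i) →
            (φ : S⟨ ℓ ⟩ a ≅ S⟨ ℓ ⟩ b) → PortMap φ
  portMap {a} {b} 2≤a 2≤b φ@(f , f-adj) = record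
    { onPorts   = onPorts
    ; onClasses = λ i → proj₁ (onPorts (rep i))
    ; onPorts-≡ = λ p → proj₂ (image p)
    ; class-≡   = λ p → contains-separates (3≤R ℓ) _ _ (same-neighbours p (rep (proj₁ p)) refl)
    }
    where
    open ≡-Reasoning
    G = S⟨ ℓ ⟩ a
    H = S⟨ ℓ ⟩ b

    rep : (i : Fin R) → Ports a
    rep i = i , aPort ℓ (λ j → ℕ.<⇒≤ (2≤a j)) i

    image : ∀ p → ∃[ p′ ] to f (port p) ≡ port p′
    image p = hasTwin⇒port {b} (λ j → ℕ.<⇒≤ (2≤b j)) (to f (port p))
      (HasTwin-≅ {G} {H} φ {port p} (port-hasTwin {a} 2≤a p))

    onPorts : Ports a → Ports b
    onPorts p = proj₁ (image p)

    neighbours : ∀ p q → contains q (proj₁ (onPorts p)) ≡ adj G (port p) (from f (pair q))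
    neighbours p q = trans (cong (λ u → adj H u (pair q)) (sym (proj₂ (image p)))) (≅-adj-from {G} {H} φ (port p) (pair q))

    same-class : ∀ p p′ → proj₁ p ≡ proj₁ p′ → ∀ u → adj G (port p) u ≡ adj G (port p′) u
    same-class p p′ eq (port _) = refl
    same-class p p′ eq (pair q) = cong (contains q) eq
    same-class p p′ eq (sel _)  = refl

    same-neighbours : ∀ p p′ → proj₁ p ≡ proj₁ p′ → ∀ q → contains q (proj₁ (onPorts p)) ≡ contains q (proj₁ (onPorts p′))
    same-neighbours p p′ eq q =
      trans (neighbours p q) (trans (same-class p p′ eq (from f (pair q))) (sym (neighbours p′ q)))

  module _ {a b : Fin R → ℕ} (2≤a : ∀ i → 2 ≤ a i) (2≤b : ∀ i → 2 ≤ b i) (φ : S⟨ ℓ ⟩ a ≅ S⟨ ℓ ⟩ b) where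
    private
      G = S⟨ ℓ ⟩ a
      H = S⟨ ℓ ⟩ b
      f = proj₁ φ
      f-adj = proj₂ φ
      φ⁻¹ = ≅-sym {G} {H} φ
      open PortMap (portMap 2≤a 2≤b φ)
      module Inv = PortMap (portMap 2≤b 2≤a φ⁻¹)

      rep : (i : Fin R) → Ports a
      rep i = i , aPort ℓ (λ j → ℕ.<⇒≤ (2≤a j)) i

      rep′ : (i : Fin R) → Ports b
      rep′ i = i , aPort ℓ (λ j → ℕ.<⇒≤ (2≤b j)) i

      onPorts-inverse : ∀ p → Inv.onPorts (onPorts p) ≡ p
      onPorts-inverse p = inj₁-injective (trans (sym (Inv.onPorts-≡ (onPorts p)))
        (trans (cong (from f) (sym (onPorts-≡ p))) (strictlyInverseʳ f (port p))))

      onClasses-inverse : ∀ i → Inv.onClasses (onClasses i) ≡ i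
      onClasses-inverse i = begin
        Inv.onClasses (onClasses i)                ≡⟨ cong Inv.onClasses (class-≡ (rep i)) ⟨
        Inv.onClasses (proj₁ (onPorts (rep i)))    ≡⟨ Inv.class-≡ (onPorts (rep i)) ⟨
        proj₁ (Inv.onPorts (onPorts (rep i)))      ≡⟨ cong proj₁ (onPorts-inverse (rep i)) ⟩
        i                                          ∎
        where open ≡-Reasoning

      onClasses-injective : ∀ {i j} → onClasses i ≡ onClasses j → i ≡ j
      onClasses-injective {i} {j} eq =
        trans (sym (onClasses-inverse i)) (trans (cong Inv.onClasses eq) (onClasses-inverse j))

      from-port : ∀ p → from f (port p) ≡ port (Inv.onPorts p)
      from-port = Inv.onPorts-≡

      adj-rep : ∀ u i → adj H (to f u) (port (onPorts (rep i))) ≡ adj G u (port (rep i))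
      adj-rep u i = trans (cong (adj H (to f u)) (sym (onPorts-≡ (rep i)))) (f-adj u (port (rep i)))

      image-not-port : ∀ {u} → (∀ p → u ≢ port p) → ∀ p → to f u ≢ port p
      image-not-port {u} u≢port p eq = u≢port (Inv.onPorts p)
        (trans (sym (strictlyInverseʳ f u)) (trans (cong (from f) eq) (from-port p)))

      -- Ports are images of ports, and a pair is excluded because it has neighbours among the
      -- ports.
      image-sel : ∀ F → ∃[ F′ ] to f (sel F) ≡ sel F′
      image-sel F = classify (to f (sel F)) refl
        where
        classify : ∀ v → to f (sel F) ≡ v → ∃[ F′ ] to f (sel F) ≡ sel F′
        classify (port p) eq = contradiction eq (image-not-port (λ _ ()) p)
        classify (sel F′) eq = F′ , eq
        classify (pair q) eq = contradiction (begin
            true                                                        ≡⟨ contains-fst q ⟨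
            adj H (pair q) (port (rep′ i))                              ≡⟨ cong (λ v → adj H v (port (rep′ i))) eq ⟨
            adj H (to f (sel F)) (port (rep′ i))                        ≡⟨ ≅-adj-from {G} {H} φ (sel F) (port (rep′ i)) ⟩
            adj G (sel F) (from f (port (rep′ i)))                      ≡⟨ cong (adj G (sel F)) (from-port (rep′ i)) ⟩
            false                                                       ∎)
          λ ()
          where
          open ≡-Reasoning
          i = proj₁ (value q)

      -- The image is adjacent to ports, so it is no selector; being a pair, it must contain the
      -- images of both labels.
      image-pair : ∀ i j (i≢j : i ≢ j) →
                   to f (pair (⁅ i , j ⁆ i≢j)) ≡ pair (⁅ onClasses i , onClasses j ⁆ (i≢j ∘ onClasses-injective))
      image-pair i j i≢j = classify (to f (pair q)) refl
        where
        q = ⁅ i , j ⁆ i≢j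
        πi≢πj = i≢j ∘ onClasses-injective

        contains-image : ∀ l → l ≡ i ⊎ l ≡ j → adj H (to f (pair q)) (port (onPorts (rep l))) ≡ true
        contains-image l l∈ = trans (adj-rep (pair q) l) (∈-⁅⁆ i j i≢j l∈)

        classify : ∀ v → to f (pair q) ≡ v → to f (pair q) ≡ pair (⁅ onClasses i , onClasses j ⁆ πi≢πj)
        classify (port p) eq = contradiction eq (image-not-port (λ _ ()) p)
        classify (sel F)  eq = contradiction
          (trans (sym (contains-image i (inj₁ refl))) (cong (λ v → adj H v (port (onPorts (rep i)))) eq)) λ ()
        classify (pair q′) eq = trans eq (cong pair (pair-unique (onClasses i) (onClasses j) πi≢πj
          (at i (inj₁ refl)) (at j (inj₂ refl))
          (∈-⁅⁆ _ _ πi≢πj (inj₁ refl)) (∈-⁅⁆ _ _ πi≢πj (inj₂ refl))))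
          where
          at : ∀ l → l ≡ i ⊎ l ≡ j → contains q′ (onClasses l) ≡ true
          at l l∈ = trans (cong (contains q′) (sym (class-≡ (rep l))))
            (trans (cong (λ v → adj H v (port (onPorts (rep l)))) (sym eq)) (contains-image l l∈))

      image-edge : ∀ F F′ → to f (sel F) ≡ sel F′ →
                   ∀ i j → edge (value F′) (onClasses i) (onClasses j) ≡ edge (value F) i j
      image-edge F F′ eq i j = by-equality (i Fin.≟ j)
        where
        open ≡-Reasoning
        by-equality : Dec (i ≡ j) → edge (value F′) (onClasses i) (onClasses j) ≡ edge (value F) i j
        by-equality (yes refl) = trans (edge-irrefl (value F′) (onClasses i)) (sym (edge-irrefl (value F) i))
        by-equality (no i≢j)   = begin
          edge (value F′) (onClasses i) (onClasses j)             ≡⟨ edgeAt-⁅⁆ (value F′) _ _ (i≢j ∘ onClasses-injective) ⟨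
          adj H (sel F′) (pair (⁅ onClasses i , onClasses j ⁆ _)) ≡⟨ cong₂ (adj H) eq (image-pair i j i≢j) ⟨
          adj H (to f (sel F)) (to f (pair (⁅ i , j ⁆ i≢j)))      ≡⟨ f-adj (sel F) (pair (⁅ i , j ⁆ i≢j)) ⟩
          adj G (sel F) (pair (⁅ i , j ⁆ i≢j))                    ≡⟨ edgeAt-⁅⁆ (value F) i j i≢j ⟩
          edge (value F) i j                                      ∎

    -- The map of classes is returned as a function, and parity is asserted of every permutation
    -- that agrees with it. The selector of the seed is sent to a graph that equals both the image
    -- under `τ` and the image under an even representative; the two differ by a stabiliser of the
    -- seed, which is even.
    iso⇒even : Σ[ π ∈ (Fin R → Fin R) ] ((∀ i → b (π i) ≡ a i) ×
               (∀ (τ : Permutation′ R) → (∀ i → τ ⟨$⟩ʳ i ≡ π i) → sgn τ ≡ 0ℙ))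
    iso⇒even = onClasses , sizes , even
      where
      sizes : ∀ i → b (onClasses i) ≡ a i
      sizes i = ℕ.≤-antisym
        (subst (λ j → b (onClasses i) ≤ a j) (onClasses-inverse i) (Inv.size-≤ (onClasses i))) (size-≤ i)

      F₀ : 𝓕 ℓ
      F₀ = X ℓ ,ᵣ [ Perm.id , sgn⇒even {σ = Perm.id} (sgn-id {R}) , sym (·-id (X ℓ)) ]

      F₁ : 𝓕 ℓ
      F₁ = proj₁ (image-sel F₀)

      even : ∀ (τ : Permutation′ R) → (∀ i → τ ⟨$⟩ʳ i ≡ onClasses i) → sgn τ ≡ 0ℙ
      even τ τ≡π = begin
        sgn τ                      ≡⟨ ℙ.+-identityʳ (sgn τ) ⟨
        sgn τ ℙ.+ 0ℙ               ≡⟨ cong (sgn τ ℙ.+_) (trans (sgn-flip σ) (σ-even ℓ F₁)) ⟨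
        sgn τ ℙ.+ sgn (flip σ)     ≡⟨ sgn-∘ τ (flip σ) ⟨
        sgn (τ ∘ₚ flip σ)          ≡⟨ stabilizer-X-even ℓ (τ ∘ₚ flip σ) fixes ⟩
        0ℙ                         ∎
        where
        open ≡-Reasoning
        import Data.Parity.Properties as ℙ
        σ = σ⟨ ℓ , F₁ ⟩

        F₁≡τX : value F₁ ≡ τ · X ℓ
        F₁≡τX = ·-unique τ (X ℓ) λ i j →
          trans (cong₂ (edge (value F₁)) (τ≡π i) (τ≡π j)) (image-edge F₀ F₁ (proj₂ (image-sel F₀)) i j)

        fixes : (τ ∘ₚ flip σ) · X ℓ ≡ X ℓ
        fixes = trans (·-∘ τ (flip σ) (X ℓ))
          (trans (cong (flip σ ·_) (trans (sym F₁≡τX) (σ·X ℓ F₁))) (·-flip σ (X ℓ)))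

-- Numbers of vertices

module ∑ℕ = Algebra.Properties.CommutativeMonoid.Sum ℕ.+-0-commutativeMonoid

ports-suc↔ : (a : Fin (suc r) → ℕ) → Ports a ↔ (Fin (a 0F) ⊎ Ports (a ∘ suc))
ports-suc↔ a = mk↔ₛ′
  (λ { (zero , c) → inj₁ c ; (suc i , c) → inj₂ (i , c) })
  (λ { (inj₁ c) → zero , c ; (inj₂ (i , c)) → suc i , c })
  (λ { (inj₁ _) → refl ; (inj₂ _) → refl })
  (λ { (zero , _) → refl ; (suc _ , _) → refl })

ports↔ : (a : Fin r → ℕ) → Ports a ↔ Fin (∑ℕ.sum a)
ports↔ {zero}  a = mk↔ₛ′ (λ ()) (λ ()) (λ ()) (λ ())
ports↔ {suc r} a = ↔-sym Fin.+↔⊎ ↔-∘ ((↔-id (Fin (a 0F)) ⊎-↔ ports↔ (a ∘ suc)) ↔-∘ ports-suc↔ a)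

size-ports : (a : Fin r → ℕ) → Finite.size (finite-Σ a) ≡ ∑ℕ.sum a
size-ports a = Perm.↔⇒≡ (ports↔ a ↔-∘ ↔-sym (Finite.index (finite-Σ a)))

triangular : ℕ → ℕ
triangular zero    = 0
triangular (suc r) = suc r + triangular r

triangular-*2 : ∀ r → triangular r * 2 ≡ r * (r + 1)
triangular-*2 zero    = refl
triangular-*2 (suc r) = begin
  (suc r + triangular r) * 2     ≡⟨ ℕ.*-distribʳ-+ 2 (suc r) (triangular r) ⟩
  suc r * 2 + triangular r * 2   ≡⟨ cong (λ x → suc r * 2 + x) (triangular-*2 r) ⟩
  suc r * 2 + r * (r + 1)        ≡⟨ solve 1 (λ r → (con 1 :+ r) :* con 2 :+ r :* (r :+ con 1) :=
                                                   (con 1 :+ r) :* (con 1 :+ r :+ con 1)) refl r ⟩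
  suc r * (suc r + 1)            ∎
  where
  open ≡-Reasoning
  open +-*-Solver

triangular-/2 : ∀ r → r * (r + 1) ℕ./ 2 ≡ triangular r
triangular-/2 r = trans (cong (ℕ._/ 2) (sym (triangular-*2 r))) (m*n/n≡m (triangular r) 2)

-- Dropping the first class is the same as raising `t` by one with one class fewer. This drives the
-- induction for `sum-𝐚` and counts the ports outside the first class.
sum-𝐚-suc : ∀ r t → ∑ℕ.sum {r} (λ j → 𝐚 {suc r} t (suc j)) ≡ ∑ℕ.sum (𝐚 {r} (suc t))
sum-𝐚-suc r t = ∑ℕ.sum-cong-≗ {r} λ j → ℕ.+-suc t (suc (toℕ j))

sum-𝐚 : ∀ r t → ∑ℕ.sum (𝐚 {r} t) ≡ r * t + triangular r
sum-𝐚 zero    t = refl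
sum-𝐚 (suc r) t = begin
  (t + 1) + ∑ℕ.sum {r} (λ j → 𝐚 {suc r} t (suc j))   ≡⟨ cong (λ x → (t + 1) + x) (trans (sum-𝐚-suc r t) (sum-𝐚 r (suc t))) ⟩
  (t + 1) + (r * suc t + triangular r)               ≡⟨ solve 3 (λ t r x → (t :+ con 1) :+ (r :* (con 1 :+ t) :+ x) :=
                                                          (con 1 :+ r) :* t :+ (con 1 :+ r :+ x)) refl t r (triangular r) ⟩
  suc r * t + (suc r + triangular r)                 ∎
  where
  open ≡-Reasoning
  open +-*-Solver

order-𝐆 : (ℓ : Labelling (suc (suc k))) (t : ℕ) → Graph.order (𝐆 ℓ t) ≡ orderFormula (suc (suc k)) t
order-𝐆 {k} ℓ t = cong₂ _+_
  (trans (size-ports (𝐚 t)) (trans (sum-𝐚 R t) (cong (λ x → R * t + x) (sym (triangular-/2 R)))))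
  (cong₂ _+_ (size-Pair R) (size-𝓕 ℓ))
  where R = 2 * suc (suc k)

-- Common cards

commonCards≤b : (G H : Graph) {m : ℕ} → CommonCards G H m → m ≤ b G H
commonCards≤b G H {m} = proj₂ (proj₂ (maxCommonCards G H)) m

swap₁₂ : Permutation′ (suc (suc n))
swap₁₂ = transpose 0F 1F

𝐛-swap₁₂ : ∀ t i → 𝐛 {suc (suc n)} t (swap₁₂ ⟨$⟩ʳ i) ≡ 𝐚 t i
𝐛-swap₁₂ t 0F            = refl
𝐛-swap₁₂ t 1F            = refl
𝐛-swap₁₂ t (suc (suc i)) = refl

swap₁₂-involutive : (i : Fin (suc (suc n))) → swap₁₂ ⟨$⟩ʳ (swap₁₂ ⟨$⟩ʳ i) ≡ i
swap₁₂-involutive 0F            = refl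
swap₁₂-involutive 1F            = refl
swap₁₂-involutive (suc (suc i)) = refl

module _ {k : ℕ} (ℓ : Labelling (suc (suc k))) (t : ℕ) where
  private
    R R-1 : ℕ
    R   = 2 * suc (suc k)
    R-1 = R ∸ 1

  -- All ports outside the first class.
  commonCards : CommonCards (𝐆 ℓ t) (𝐇 ℓ t) (∑ℕ.sum {R-1} (λ j → 𝐚 {R} t (suc j)))
  commonCards = v , w , v-injective , w-injective , λ m →
    -- The class of `suc j` is paired with the one just before it, which is smaller by exactly one.
    let (j , c) = from all m in card-≅ ℓ swap₁₂ (𝐛-swap₁₂ t) sgn-transpose-01
      {suc j} {inject₁ j} (suc≢inject₁ j) (size-step j) c
    where
    all : Ports {R-1} (λ j → 𝐚 {R} t (suc j)) ↔ Fin (∑ℕ.sum {R-1} (λ j → 𝐚 {R} t (suc j)))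
    all = ports↔ {R-1} (λ j → 𝐚 {R} t (suc j))

    include : Ports {R-1} (λ j → 𝐚 {R} t (suc j)) → Ports (𝐚 {R} t)
    include (j , c) = suc j , c

    include-injective : ∀ {p q} → include p ≡ include q → p ≡ q
    include-injective {p} {q} eq = ports-≡ {p = p} {q} (Fin.suc-injective (cong proj₁ eq)) (cong (toℕ ∘ proj₂) eq)

    v : Fin _ → V (𝐆 ℓ t)
    v m = port (include (from all m))
    w : Fin _ → V (𝐇 ℓ t)
    w m = port (to (relabel swap₁₂ (𝐛-swap₁₂ t)) (include (from all m)))

    v-injective : ∀ {m n} → v m ≡ v n → m ≡ n
    v-injective eq = to-injective (↔-sym all) (include-injective (inj₁-injective eq))

    w-injective : ∀ {m n} → w m ≡ w n → m ≡ n
    w-injective eq = to-injective (↔-sym all) (include-injective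
      (to-injective (relabel swap₁₂ (𝐛-swap₁₂ t)) (inj₁-injective eq)))

    suc≢inject₁ : (j : Fin R-1) → suc j ≢ inject₁ j
    suc≢inject₁ j eq = ℕ.1+n≢n (trans (cong toℕ eq) (Fin.toℕ-inject₁ j))

    size-step : (j : Fin R-1) → 𝐚 {R} t (suc j) ≡ suc (𝐚 {R} t (inject₁ j))
    size-step j = trans (ℕ.+-suc t (suc (toℕ j))) (cong (λ x → suc (t + suc x)) (sym (Fin.toℕ-inject₁ j)))

  lowerBound≡ : lowerBound (suc (suc k)) t ≡ R-1 * suc t + triangular R-1
  lowerBound≡ = begin
    R-1 * t + R * (R + 1) ℕ./ 2 ∸ 1              ≡⟨ cong (λ x → R-1 * t + x ∸ 1) (triangular-/2 R) ⟩
    -- `R` is a successor by computation, so the triangular number exposes a successor and the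
    -- subtraction of 1 is exact.
    R-1 * t + suc (R-1 + triangular R-1) ∸ 1     ≡⟨ cong (_∸ 1) (ℕ.+-suc (R-1 * t) (R-1 + triangular R-1)) ⟩
    R-1 * t + (R-1 + triangular R-1)             ≡⟨ solve 3 (λ r t x → r :* t :+ (r :+ x) := r :* (con 1 :+ t) :+ x) refl R-1 t (triangular R-1) ⟩
    R-1 * suc t + triangular R-1                 ∎
    where
    open ≡-Reasoning
    open +-*-Solver

  lowerBound≤b : lowerBound (suc (suc k)) t ≤ b (𝐆 ℓ t) (𝐇 ℓ t)
  lowerBound≤b = subst (_≤ b (𝐆 ℓ t) (𝐇 ℓ t))
    (trans (sum-𝐚-suc R-1 t) (trans (sum-𝐚 R-1 (suc t)) (sym lowerBound≡)))
    (commonCards≤b (𝐆 ℓ t) (𝐇 ℓ t) commonCards)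

  -- The excess consists of the t + 1 ports of the first class and the pairs and selectors counted
  -- by `constC`.
  orderFormula≡ : orderFormula (suc (suc k)) t ≡ lowerBound (suc (suc k)) t + (t + suc (constC (suc (suc k))))
  orderFormula≡ = begin
    R * t + R * (R + 1) ℕ./ 2 + extra                          ≡⟨ cong (λ x → R * t + x + extra) (triangular-/2 R) ⟩
    suc R-1 * t + (suc R-1 + triangular R-1) + extra           ≡⟨ solve 4 (λ r t x c → (con 1 :+ r) :* t :+ (con 1 :+ r :+ x) :+ c :=
                                                                 r :* (con 1 :+ t) :+ x :+ (t :+ (con 1 :+ c))) refl R-1 t (triangular R-1) extra ⟩
    R-1 * suc t + triangular R-1 + (t + suc extra)             ≡⟨ cong (_+ (t + suc extra)) lowerBound≡ ⟨
    lowerBound (suc (suc k)) t + (t + suc extra)               ∎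
    where
    open ≡-Reasoning
    open +-*-Solver
    extra = constC (suc (suc k))

  1≤t⇒2≤𝐚 : 1 ≤ t → (i : Fin R) → 2 ≤ 𝐚 t i
  1≤t⇒2≤𝐚 1≤t i = ℕ.+-mono-≤ 1≤t (s≤s z≤n)

  1≤t⇒2≤𝐛 : 1 ≤ t → (i : Fin R) → 2 ≤ 𝐛 t i
  1≤t⇒2≤𝐛 1≤t i = subst (λ j → 2 ≤ 𝐛 t j) (swap₁₂-involutive i)
    (subst (2 ≤_) (sym (𝐛-swap₁₂ t (swap₁₂ ⟨$⟩ʳ i))) (1≤t⇒2≤𝐚 1≤t (swap₁₂ ⟨$⟩ʳ i)))

  -- The sizes in `𝐚 t` are distinct, so the only map of classes that respects sizes is `swap₁₂`,
  -- and this is odd.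
  𝐆≇𝐇 : 1 ≤ t → ¬ (𝐆 ℓ t ≅ 𝐇 ℓ t)
  𝐆≇𝐇 1≤t φ = even≢odd (trans (sym (even swap₁₂ swap≡π)) sgn-transpose-01)
    where
    even≢odd : 0ℙ ≢ 1ℙ
    even≢odd ()

    iso = iso⇒even ℓ {𝐚 t} {𝐛 t} (1≤t⇒2≤𝐚 1≤t) (1≤t⇒2≤𝐛 1≤t) φ
    π = proj₁ iso
    even = proj₂ (proj₂ iso)

    𝐚-injective : {i j : Fin R} → 𝐚 t i ≡ 𝐚 t j → i ≡ j
    𝐚-injective eq = Fin.toℕ-injective (ℕ.suc-injective (ℕ.+-cancelˡ-≡ t _ _ eq))

    swap≡π : ∀ i → swap₁₂ ⟨$⟩ʳ i ≡ π i
    swap≡π i = trans (cong (swap₁₂ ⟨$⟩ʳ_) (𝐚-injective (begin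
        𝐚 t i                                          ≡⟨ proj₁ (proj₂ iso) i ⟨
        𝐛 t (π i)                                      ≡⟨ cong (𝐛 t) (swap₁₂-involutive (π i)) ⟨
        𝐛 t (swap₁₂ ⟨$⟩ʳ (swap₁₂ ⟨$⟩ʳ π i))            ≡⟨ 𝐛-swap₁₂ t (swap₁₂ ⟨$⟩ʳ π i) ⟩
        𝐚 t (swap₁₂ ⟨$⟩ʳ π i)                          ∎)))
      (swap₁₂-involutive (π i))
      where open ≡-Reasoning

  properties : 1 ≤ t →
    Connected (𝐆 ℓ t) × Connected (𝐇 ℓ t) × ¬ (𝐆 ℓ t ≅ 𝐇 ℓ t) × SameDegreeSequence (𝐆 ℓ t) (𝐇 ℓ t) ×
    Graph.order (𝐆 ℓ t) ≡ orderFormula (suc (suc k)) t × Graph.order (𝐇 ℓ t) ≡ orderFormula (suc (suc k)) t ×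
    lowerBound (suc (suc k)) t ≤ b (𝐆 ℓ t) (𝐇 ℓ t)
  properties 1≤t =
    connected-blowUp ℓ (λ i → ℕ.<⇒≤ (1≤t⇒2≤𝐚 1≤t i)) ,
    connected-blowUp ℓ (λ i → ℕ.<⇒≤ (1≤t⇒2≤𝐛 1≤t i)) ,
    𝐆≇𝐇 1≤t ,
    sameDegreeSequence-blowUp ℓ swap₁₂ (𝐛-swap₁₂ t) ,
    order-𝐆 ℓ t ,
    trans (sym (order-blowUp ℓ {𝐚 t} {𝐛 t} swap₁₂ (𝐛-swap₁₂ t))) (order-𝐆 ℓ t) ,
    lowerBound≤b

-- The limit inferior

-- The hypothesis is the conclusion with denominators cleared. Unnormalised rationals keep the
-- denominators as plain products, without reduction to lowest terms.
1≤sum-of-fractions : ∀ x n r q .{{_ : NonZero n}} .{{_ : NonZero r}} .{{_ : NonZero q}} →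
  n * r * q ≤ (x * r + n) * q + n * r →
  1ℚ ℚ.≤ (+ x / n) ℚ.+ (+ 1 / q) ℚ.+ (+ 1 / r)
1≤sum-of-fractions x (suc n) (suc r) (suc q) le = ℚ.toℚᵘ-cancel-≤ (begin
  ℚᵘ.1ℚᵘ
    ≤⟨ *≤* cross-multiplied ⟩
  mkℚᵘ (+ x) n ℚᵘ.+ mkℚᵘ (+ 1) q ℚᵘ.+ mkℚᵘ (+ 1) r
    ≃⟨ ℚᵘ.+-cong (ℚᵘ.+-cong (ℚ.toℚᵘ-fromℚᵘ (mkℚᵘ (+ x) n)) (ℚ.toℚᵘ-fromℚᵘ (mkℚᵘ (+ 1) q))) (ℚ.toℚᵘ-fromℚᵘ (mkℚᵘ (+ 1) r)) ⟨
  ℚ.toℚᵘ ξ ℚᵘ.+ ℚ.toℚᵘ ζ ℚᵘ.+ ℚ.toℚᵘ ρ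
    ≃⟨ ℚᵘ.+-congˡ (ℚ.toℚᵘ ρ) (ℚ.toℚᵘ-homo-+ ξ ζ) ⟨
  ℚ.toℚᵘ (ξ ℚ.+ ζ) ℚᵘ.+ ℚ.toℚᵘ ρ
    ≃⟨ ℚ.toℚᵘ-homo-+ (ξ ℚ.+ ζ) ρ ⟨
  ℚ.toℚᵘ (ξ ℚ.+ ζ ℚ.+ ρ) ∎)
  where
  open ℚᵘ.≤-Reasoning
  ξ = + x / suc n
  ζ = + 1 / suc q
  ρ = + 1 / suc r

  numerator : ((+ x ℤ.* + suc q ℤ.+ + 1 ℤ.* + suc n) ℤ.* + suc r ℤ.+ + 1 ℤ.* + (suc n * suc q)) ℤ.* + 1
              ≡ + ((x * suc q + suc n) * suc r + suc n * suc q)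
  numerator
    rewrite ℤ.*-identityˡ (+ suc n) | ℤ.*-identityˡ (+ (suc n * suc q)) | sym (ℤ.pos-* x (suc q))
          | sym (ℤ.pos-* (x * suc q + suc n) (suc r)) = ℤ.*-identityʳ _

  rearranged : 1 * (suc n * suc q * suc r) ≤ (x * suc q + suc n) * suc r + suc n * suc q
  rearranged = ℕ.≤-trans (ℕ.≤-reflexive (solve 3 (λ n q r → con 1 :* (n :* q :* r) := n :* r :* q) refl (suc n) (suc q) (suc r)))
    (ℕ.≤-trans le (ℕ.≤-reflexive (solve 4 (λ x n r q → (x :* r :+ n) :* q :+ n :* r := (x :* q :+ n) :* r :+ n :* q)
      refl x (suc n) (suc r) (suc q))))
    where open +-*-Solver

  cross-multiplied : + 1 ℤ.* + (suc n * suc q * suc r) ℤ.≤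
    ((+ x ℤ.* + suc q ℤ.+ + 1 ℤ.* + suc n) ℤ.* + suc r ℤ.+ + 1 ℤ.* + (suc n * suc q)) ℤ.* + 1
  cross-multiplied = ℤ.≤-trans (ℤ.≤-reflexive (sym (ℤ.pos-* 1 (suc n * suc q * suc r))))
    (ℤ.≤-trans (ℤ.+≤+ rearranged) (ℤ.≤-reflexive (sym numerator)))

-- The deficit of `L` against `n` has two parts: `t`, at most the fraction 1/r of `n`, and the
-- constant `c`, at most 1/q of it.
cross-multiplied-bound : ∀ {L x n} r q {t c} → n ≡ L + (t + c) → L ≤ x → r * t ≤ n → c * q ≤ n →
                         n * r * q ≤ (x * r + n) * q + n * r
cross-multiplied-bound {L} {x} {n} r q {t} {c} n≡ L≤x rt≤n cq≤n = begin
  n * r * q                       ≡⟨ cong (λ m → m * r * q) n≡ ⟩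
  (L + (t + c)) * r * q           ≡⟨ solve 5 (λ L t c r q → (L :+ (t :+ c)) :* r :* q :=
                                       (L :* r :+ r :* t) :* q :+ c :* q :* r) refl L t c r q ⟩
  (L * r + r * t) * q + c * q * r ≤⟨ ℕ.+-mono-≤ (ℕ.*-monoˡ-≤ q (ℕ.+-mono-≤ (ℕ.*-monoˡ-≤ r L≤x) rt≤n)) (ℕ.*-monoˡ-≤ r cq≤n) ⟩
  (x * r + n) * q + n * r         ∎
  where
  open ℕ.≤-Reasoning
  open +-*-Solver

1/denominator≤ : ∀ p d .(c : Coprime (suc p) (suc d)) → + 1 / suc d ℚ.≤ mkℚ (+ suc p) d c
1/denominator≤ p d c = ℚ.toℚᵘ-cancel-≤ (begin
  ℚ.toℚᵘ (+ 1 / suc d)  ≃⟨ ℚ.toℚᵘ-fromℚᵘ (mkℚᵘ (+ 1) d) ⟩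
  mkℚᵘ (+ 1) d          ≤⟨ *≤* (ℤ.*-monoʳ-≤-nonNeg (+ suc d) (ℤ.+≤+ {1} {suc p} (s≤s z≤n))) ⟩
  mkℚᵘ (+ suc p) d      ∎)
  where open ℚᵘ.≤-Reasoning

≤+⇒-≤ : ∀ x y z → x ℚ.≤ y ℚ.+ z → x - z ℚ.≤ y
≤+⇒-≤ x y z x≤y+z = subst (x - z ℚ.≤_) (Group.//-rightDividesʳ ℚ.+-0-group z y) (ℚ.+-monoˡ-≤ (ℚ.- z) x≤y+z)

fraction-bound : ∀ x n r p d .(c : Coprime (suc p) (suc d)) .{{_ : NonZero n}} .{{_ : NonZero r}} →
  n * r * suc d ≤ (x * r + n) * suc d + n * r →
  1ℚ - (+ 1 / r) - mkℚ (+ suc p) d c ℚ.≤ + x / n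
fraction-bound x n r p d c le =
  ℚ.≤-trans (ℚ.+-monoʳ-≤ (1ℚ - (+ 1 / r)) (ℚ.neg-antimono-≤ (1/denominator≤ p d c)))
    (≤+⇒-≤ (1ℚ - (+ 1 / r)) (+ x / n) (+ 1 / suc d)
      (≤+⇒-≤ 1ℚ ((+ x / n) ℚ.+ (+ 1 / suc d)) (+ 1 / r) (1≤sum-of-fractions x n r (suc d) le)))

module _ {k : ℕ} (ℓ : Labelling (suc (suc k))) (t : ℕ) where
  private
    K R extra : ℕ
    K = suc (suc k)
    R = 2 * K
    extra = constC K

  t≤order : t ≤ orderFormula (suc (suc k)) t
  t≤order = subst (t ≤_) (sym (orderFormula≡ ℓ t))
    (ℕ.≤-trans (ℕ.m≤m+n t (suc extra)) (ℕ.m≤n+m (t + suc extra) (lowerBound K t)))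

  Rt≤order : 2 * suc (suc k) * t ≤ orderFormula (suc (suc k)) t
  Rt≤order = ℕ.≤-trans (ℕ.m≤m+n (R * t) (R * (R + 1) ℕ./ 2)) (ℕ.m≤m+n (R * t + R * (R + 1) ℕ./ 2) extra)

  eventual-bound : ∀ q → suc (constC (suc (suc k))) * q ≤ t →
    orderFormula (suc (suc k)) t * (2 * suc (suc k)) * q ≤
    (b (𝐆 ℓ t) (𝐇 ℓ t) * (2 * suc (suc k)) + orderFormula (suc (suc k)) t) * q +
      orderFormula (suc (suc k)) t * (2 * suc (suc k))
  eventual-bound q T≤t = cross-multiplied-bound {lowerBound (suc (suc k)) t} {b (𝐆 ℓ t) (𝐇 ℓ t)}
    {orderFormula (suc (suc k)) t} (2 * suc (suc k)) q {t} {suc (constC (suc (suc k)))}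
    (orderFormula≡ ℓ t) (lowerBound≤b ℓ t) Rt≤order (ℕ.≤-trans T≤t t≤order)

limInf-fraction : (x n : ℕ → ℕ) (r c : ℕ) .(n≢0 : ∀ t → NonZero (n t)) .(r≢0 : NonZero r) →
  (∀ t q → c * q ≤ t → n t * r * q ≤ (x t * r + n t) * q + n t * r) →
  LimInf≥ (λ t → _/_ (+ x t) (n t) {{n≢0 t}}) (1ℚ - _/_ (+ 1) r {{r≢0}})
limInf-fraction x n r c n≢0 r≢0 le (mkℚ (+ 0)    _ _) (*<* (+<+ ()))
limInf-fraction x n r c n≢0 r≢0 le (mkℚ -[1+ _ ] _ _) (*<* ())
-- A positive ε is at least the reciprocal of its denominator `suc d`, so that reciprocal serves as
-- tolerance; from `c * suc d` on, the hypothesis supplies the inequality for it.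
limInf-fraction x n r c n≢0 r≢0 le (mkℚ (+ suc p) d coprime) _ = c * suc d , λ t T≤t →
  fraction-bound (x t) (n t) r p d coprime {{n≢0 t}} {{r≢0}} (le t (suc d) T≤t)

limInf : (ℓ : Labelling (suc (suc k))) → LimInf≥
  (λ t → _/_ (+ b (𝐆 ℓ t) (𝐇 ℓ t)) (orderFormula (suc (suc k)) t) {{orderFormula≢0 (suc (suc k)) t}})
  (1ℚ - _/_ (+ 1) (2 * suc (suc k)) {{2k≢0 (suc (suc k))}})
limInf {k} ℓ = limInf-fraction (λ t → b (𝐆 ℓ t) (𝐇 ℓ t)) (orderFormula (suc (suc k))) (2 * suc (suc k))
  (suc (constC (suc (suc k)))) (λ t → orderFormula≢0 (suc (suc k)) t) (2k≢0 (suc (suc k))) (eventual-bound ℓ)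

theorem3p3 : (k : ℕ) → .{{_ : NonTrivial k}} → (ℓ : Labelling k) →
    ((t : ℕ) → 1 ≤ t →
    Connected (𝐆 ℓ t) ×
    Connected (𝐇 ℓ t) ×
    ¬ (𝐆 ℓ t ≅ 𝐇 ℓ t) ×
    SameDegreeSequence (𝐆 ℓ t) (𝐇 ℓ t) ×
    Graph.order (𝐆 ℓ t) ≡ orderFormula k t ×
    Graph.order (𝐇 ℓ t) ≡ orderFormula k t ×
    lowerBound k t ≤ b (𝐆 ℓ t) (𝐇 ℓ t)) ×
    LimInf≥
    (λ t → _/_ (+ b (𝐆 ℓ t) (𝐇 ℓ t)) (orderFormula k t) {{orderFormula≢0 k t}})
    (1ℚ - _/_ (+ 1) (2 * k) {{2k≢0 k}})
theorem3p3 zero          {{2≤k}} ℓ = ⊥-elim-irr (NonTrivial.nonTrivial 2≤k)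
theorem3p3 (suc zero)    {{2≤k}} ℓ = ⊥-elim-irr (NonTrivial.nonTrivial 2≤k)
theorem3p3 (suc (suc k)) ℓ = properties ℓ , limInf ℓ
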